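{- For every integer $n\ge 1$, the fourth factorial moment of the area statistic on parking functions of length $n$ is $$\mathbb{E}\big[\mathrm{Area}(\mathrm{Area}-1)(\mathrm{Area}-2)(\mathrm{Area}-3)\big]=\frac{221}{1008}n^{6}+\frac{63737}{30240}n^{5}+\frac{101897}{15120}n^{4}+\frac{22217}{5040}n^{3}-\frac{1375}{189}n^{2}-\frac{187463}{30240}n$$ $$+\left(-\frac{35}{16}n^{4}-\frac{449}{27}n^{3}-\frac{130243}{2520}n^{2}-\frac{7409}{105}n-\frac{503803}{15120}\right)E_1(n),$$ and asymptotically it equals $\frac{221}{1008}n^{6}+O(n^{11/2})$ as $n\to\infty$.
   Context: A parking function of length $n$ is a vector $(p_1,\dots,p_n)$ of positive integers such that its weakly increasing rearrangement $p_{(1)}\le p_{(2)}\le\dots\le p_{(n)}$ satisfies $p_{(i)}\le i$ for all $1\le i\le n$. There are $(n+1)^{n-1}$ of them. The area statistic is $\mathrm{Area}(p)=\frac{n(n+1)}{2}-\sum_{i=1}^n p_i$. Expectations are taken with respect to the uniform distribution on the set of parking functions of length $n$; the $k$-th factorial moment is $\mathbb{E}[\mathrm{Area}(\mathrm{Area}-1)\cdots(\mathrm{Area}-k+1)]$. Here $E_1(n)$ denotes $$E_1(n)= -\frac{n}{2}+\frac{1}{2}\,\frac{(n+1)!}{(n+1)^{n}}\sum_{k=0}^{n-1}\frac{(n+1)^k}{k!},$$ which is the expectation of the area statistic on parking functions of length $n$. -}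

module Defs where

open import Data.Bool using (Bool; true; false; _∧_; T)
open import Data.Nat as ℕ using (ℕ; zero; suc; _≤ᵇ_; _!)
open import Data.Nat.Properties using (_!≢0; m^n≢0; ≤-decTotalOrder)
open import Data.List using (List; []; _∷_; map; concatMap; upTo; foldr; length)
open import Data.List.Sort.InsertionSort ≤-decTotalOrder using (sort)
open import Data.Integer using (+_)
open import Data.Rational using (ℚ; _/_; _+_; _*_; _-_; -_; 0ℚ; 1ℚ)

⟦_⟧ : ℕ → ℚ
⟦ n ⟧ = (+ n) / 1

_^q_ : ℚ → ℕ → ℚ
q ^q zero = 1ℚ
q ^q suc k = q * (q ^q k)

sumℚ : List ℚ → ℚ
sumℚ = foldr _+_ 0ℚ

sumℕ : List ℕ → ℕ
sumℕ = foldr ℕ._+_ 0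

-- A vector (p₁,…,pₙ) is represented as a list of length n.
-- Parking condition on the weakly increasing rearrangement
-- p₍₁₎ ≤ … ≤ p₍ₙ₎ : each p₍ᵢ₎ is a positive integer with p₍ᵢ₎ ≤ i.
sortedCheck : ℕ → List ℕ → Bool
sortedCheck i [] = true
sortedCheck i (x ∷ xs) = (1 ≤ᵇ x) ∧ ((x ≤ᵇ i) ∧ sortedCheck (suc i) xs)

isParkingFunction : List ℕ → Bool
isParkingFunction p = sortedCheck 1 (sort p)

vectors : ℕ → ℕ → List (List ℕ)
vectors m zero = [] ∷ []
vectors m (suc len) = concatMap (λ v → map (λ x → x ∷ v) (map suc (upTo m))) (vectors m len)

filterᵇ : {A : Set} → (A → Bool) → List A → List A
filterᵇ f [] = []
filterᵇ f (x ∷ xs) with f x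
... | true = x ∷ filterᵇ f xs
... | false = filterᵇ f xs

-- The set of parking functions of length n (every entry of a parking
-- function of length n lies in {1,…,n}, so this enumerates all of them).
parkingFunctions : ℕ → List (List ℕ)
parkingFunctions n = filterᵇ isParkingFunction (vectors n n)

area : ℕ → List ℕ → ℚ
area n p = ((+ (n ℕ.* suc n)) / 2) - ⟦ sumℕ p ⟧

fallingFactorial4 : ℚ → ℚ
fallingFactorial4 a = a * (a - 1ℚ) * (a - ⟦ 2 ⟧) * (a - ⟦ 3 ⟧)

mean : List ℚ → ℚ
mean [] = 0ℚ
mean (x ∷ xs) = sumℚ (x ∷ xs) * ((+ 1) / length (x ∷ xs))

expectPF : ℕ → (List ℕ → ℚ) → ℚ
expectPF n f = mean (map f (parkingFunctions n))

areaFactorialMoment4 : ℕ → ℚ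
areaFactorialMoment4 n = expectPF n (λ p → fallingFactorial4 (area n p))

E₁ : ℕ → ℚ
E₁ n = - ((+ n) / 2)
       + ((+ 1) / 2) * ((+ (suc n !)) / (suc n ℕ.^ n)) {{m^n≢0 (suc n) n}}
         * sumℚ (map (λ k → ((+ (suc n ℕ.^ k)) / (k !)) {{k !≢0}}) (upTo n))

{-# OPTIONS --safe #-}
module Submission where

-- Call a vector a-parking if its increasing rearrangement satisfies p₍ᵢ₎ ≤ a + i - 1.  Deleting
-- the entries equal to 1 gives a recurrence, in n and a, for the factorial moments of the area
-- over a-parking functions.  Let T f (n,a) = n f(n-1,a+1) and V = 1 - T, and let A be
-- multiplication by a.  The binomial averaging L in the recurrence fixes h 0 = (n+a)ⁿ, commutes
-- with T, and satisfies L A = (A - V) L.  Hence the moment sums are polynomials in A and V applied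
-- to h 10, where h j = V⁻ʲ (h 0), and checking the recurrence is a finite computation with
-- coefficients.  At a = 1 the functions h j obey a three-term recurrence, which reduces the fourth
-- moment to the number V (h 0) of parking functions and to h 1, and the ratio of these two is
-- 2 E₁(n) + 2n + 1.  For the asymptotics, (h 1)² ≤ 2 (h 0) (h 2) and h 2 = (n+1) (h 0) at a = 1
-- give E₁² = O(n³).

open import Defs
open import Data.Bool using (Bool; true; false; _∧_; if_then_else_)
open import Data.List
  using (List; []; _∷_; map; foldr; concatMap; reverse; replicate; upTo; applyUpTo; length; _++_; _∷ʳ_)
import Data.List.Properties as Listₚ
open import Data.Nat as ℕ using (ℕ; zero; suc; z≤n; s≤s; _!; _<ᵇ_; _≤ᵇ_)
import Data.Nat.Properties as ℕₚ
open import Data.Nat.Properties using (_!≢0; m^n≢0)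
open import Data.List.Sort.InsertionSort ℕₚ.≤-decTotalOrder using (sort; insert)
import Data.Integer.Properties as ℤₚ
import Data.Integer.Tactic.RingSolver as ℤSolver
import Data.Rational.Properties as ℚₚ
open import Data.Rational.Unnormalised using (mkℚᵘ; *≡*; _≃_)
import Data.Rational.Unnormalised.Properties as ℚᵘₚ
open import Data.Product using (_×_; _,_; proj₁; proj₂; ∃-syntax)
open import Data.Sum using (inj₁; inj₂)
open import Level using (0ℓ)
open import Relation.Nullary.Decidable using (dec⇒maybe)
open import Relation.Binary.PropositionalEquality
import Tactic.RingSolver.Core.AlmostCommutativeRing as ACR
open import Tactic.RingSolver using (solve)

-- The inverse of `V` is the series 1 + T + T² + ⋯ and not a polynomial, yet the moments involve its
-- negative powers, which are poles at T(z) = 1. Since `h j` is the power 10 - j of `V` applied to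
-- `h 10`, polynomials in `V` suffice as long as no pole exceeds that of `h 10`. For r ≥ 1 the r-th
-- moment reaches exactly `h (3 r - 2)`, hence the 10. Multiplication by `a` does not commute with
-- `V`, so operators are kept in a normal form with the powers of `a` on the left. The coefficients
-- can simply be verified, because the recurrence, the value 0 at `a = 0` for n ≥ 1, and the value
-- at `n = 0`, `a = 1` determine the moment sums. Denominators are cleared, by 240 and then by 9!,
-- so that all coefficient checks take place over the integers.

module MomentSums where

  -- Binomial sums

  open import Data.Integer using (ℤ; +_; -_; _+_; _-_; _*_; _^_)
  open import Data.Integer.Tactic.RingSolver using (solve-∀)
  open ≡-Reasoning

  -- The sum of C(n,k) g(k,l) over k + l = n. Unfolding it by Pascal's rule avoids binomial
  -- coefficients and matches the choice made at a single entry of a vector.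
  bsum : ℕ → (ℕ → ℕ → ℤ) → ℤ
  bsum zero    g = g 0 0
  bsum (suc n) g = bsum n (λ k l → g (suc k) l) + bsum n (λ k l → g k (suc l))

  bsum-cong : ∀ n {g g′} → (∀ k l → k ℕ.+ l ≡ n → g k l ≡ g′ k l) → bsum n g ≡ bsum n g′
  bsum-cong zero    e = e 0 0 refl
  bsum-cong (suc n) e = cong₂ _+_
    (bsum-cong n λ k l q → e (suc k) l (cong suc q))
    (bsum-cong n λ k l q → e k (suc l) (trans (ℕₚ.+-suc k l) (cong suc q)))

  bsum-+ : ∀ n g g′ → bsum n (λ k l → g k l + g′ k l) ≡ bsum n g + bsum n g′
  bsum-+ zero    g g′ = refl
  bsum-+ (suc n) g g′ rewrite bsum-+ n (λ k l → g (suc k) l) (λ k l → g′ (suc k) l)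
                            | bsum-+ n (λ k l → g k (suc l)) (λ k l → g′ k (suc l)) =
    lem (bsum n (λ k l → g (suc k) l)) (bsum n (λ k l → g′ (suc k) l))
        (bsum n (λ k l → g k (suc l))) (bsum n (λ k l → g′ k (suc l)))
    where
    lem : ∀ a b c d → a + b + (c + d) ≡ a + c + (b + d)
    lem = solve-∀

  bsum-* : ∀ n c g → bsum n (λ k l → c * g k l) ≡ c * bsum n g
  bsum-* zero    c g = refl
  bsum-* (suc n) c g = trans (cong₂ _+_ (bsum-* n c _) (bsum-* n c _)) (sym (ℤₚ.*-distribˡ-+ c _ _))

  -- Absorption: k · C(n+1,k) = (n+1) · C(n,k-1), and its mirror image.
  bsum-absorbˡ : ∀ n g φ → (∀ l → g 0 l ≡ + 0) → (∀ k l → g (suc k) l ≡ + suc k * φ k l) →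
                 bsum (suc n) g ≡ + suc n * bsum n φ
  bsum-absorbˡ zero    g φ g0 gs = trans (cong₂ _+_ (gs 0 0) (g0 1)) (ℤₚ.+-identityʳ _)
  bsum-absorbˡ (suc n) g φ g0 gs = begin
    bsum (suc n) (λ k l → g (suc k) l) + bsum (suc n) (λ k l → g k (suc l))
      -- In the left half k + 1 is split as 1 + k, which leaves a sum of the same shape, so that
      -- both halves fall under the induction hypothesis.
      ≡⟨ cong₂ _+_ (trans (bsum-cong (suc n) split) (bsum-+ (suc n) φ g″))
                   (bsum-absorbˡ n (λ k l → g k (suc l)) (λ k l → φ k (suc l)) (λ l → g0 (suc l)) (λ k l → gs k (suc l))) ⟩
    (bsum (suc n) φ + bsum (suc n) g″) + + suc n * bsum n (λ k l → φ k (suc l))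
      ≡⟨ cong (λ z → (bsum (suc n) φ + z) + + suc n * bsum n (λ k l → φ k (suc l)))
              (bsum-absorbˡ n g″ (λ k l → φ (suc k) l) (λ _ → refl) (λ _ _ → refl)) ⟩
    (bsum (suc n) φ + + suc n * bsum n (λ k l → φ (suc k) l)) + + suc n * bsum n (λ k l → φ k (suc l))
      ≡⟨ lem (+ suc n) (bsum n (λ k l → φ (suc k) l)) (bsum n (λ k l → φ k (suc l))) ⟩
    (+ 1 + + suc n) * bsum (suc n) φ ∎
    where
    g″ : ℕ → ℕ → ℤ
    g″ k l = + k * φ k l
    split : ∀ k l → k ℕ.+ l ≡ suc n → g (suc k) l ≡ φ k l + g″ k l
    split k l _ = trans (gs k l) (ℤₚ.suc-* (+ k) (φ k l))
    lem : ∀ c x y → ((x + y) + c * x) + c * y ≡ (+ 1 + c) * (x + y)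
    lem = solve-∀

  bsum-swap : ∀ n g → bsum n g ≡ bsum n (λ k l → g l k)
  bsum-swap zero    g = refl
  bsum-swap (suc n) g = trans (ℤₚ.+-comm (bsum n _) _) (cong₂ _+_ (bsum-swap n _) (bsum-swap n _))

  bsum-absorbʳ : ∀ n g φ → (∀ k → g k 0 ≡ + 0) → (∀ k l → g k (suc l) ≡ + suc l * φ k l) →
                 bsum (suc n) g ≡ + suc n * bsum n φ
  bsum-absorbʳ n g φ g0 gs = begin
    bsum (suc n) g                    ≡⟨ bsum-swap (suc n) g ⟩
    bsum (suc n) (λ k l → g l k)      ≡⟨ bsum-absorbˡ n (λ k l → g l k) (λ k l → φ l k) g0 (λ k l → gs l k) ⟩
    + suc n * bsum n (λ k l → φ l k)  ≡⟨ cong (+ suc n *_) (bsum-swap n φ) ⟨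
    + suc n * bsum n φ                ∎

  binomial : ∀ n x y → bsum n (λ k l → x ^ k * y ^ l) ≡ (x + y) ^ n
  binomial zero    x y = refl
  binomial (suc n) x y = begin
    bsum n (λ k l → x * x ^ k * y ^ l) + bsum n (λ k l → x ^ k * (y * y ^ l))
      ≡⟨ cong₂ _+_ (bsum-cong n λ k l _ → ℤₚ.*-assoc x (x ^ k) (y ^ l))
                   (bsum-cong n λ k l _ → lem y (x ^ k) (y ^ l)) ⟩
    bsum n (λ k l → x * (x ^ k * y ^ l)) + bsum n (λ k l → y * (x ^ k * y ^ l))
      ≡⟨ cong₂ _+_ (trans (bsum-* n x _) (cong (x *_) (binomial n x y)))
                   (trans (bsum-* n y _) (cong (y *_) (binomial n x y))) ⟩
    x * (x + y) ^ n + y * (x + y) ^ n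
      ≡⟨ ℤₚ.*-distribʳ-+ ((x + y) ^ n) x y ⟨
    (x + y) * (x + y) ^ n ∎
    where
    lem : ∀ y p q → p * (y * q) ≡ y * (p * q)
    lem = solve-∀

  -- Operators on functions of n and a, and harmonic functions

  Fun : Set
  Fun = ℕ → ℕ → ℤ

  T : Fun → Fun
  T f zero    a = + 0
  T f (suc n) a = + suc n * f n (suc a)

  V : Fun → Fun
  V f n a = f n a - T f n a

  -- The value at a = suc b.
  L : Fun → Fun
  L f n b = bsum n (λ k l → f l (b ℕ.+ k))

  -- By T(z) = z e^{T(z)}, summing zᵏ/k! e^{(b+k) T(z)} over k gives e^{(b+1) T(z)}. So these are
  -- the `f` whose exponential generating function in n is e^{a T(z)} G(z), and on them the operator
  -- `T` multiplies by T(z).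
  Harmonic : Fun → Set
  Harmonic f = ∀ n b → L f n b ≡ f n (suc b)

  T-cong : ∀ {f g} → (∀ n a → f n a ≡ g n a) → ∀ n a → T f n a ≡ T g n a
  T-cong e zero    a = refl
  T-cong e (suc n) a = cong (+ suc n *_) (e n (suc a))

  V-cong : ∀ {f g} → (∀ n a → f n a ≡ g n a) → ∀ n a → V f n a ≡ V g n a
  V-cong e n a = cong₂ _-_ (e n a) (T-cong e n a)

  L-cong : ∀ {f g} → (∀ n a → f n a ≡ g n a) → ∀ n a → L f n a ≡ L g n a
  L-cong e n b = bsum-cong n λ k l _ → e l (b ℕ.+ k)

  -- The factor `l` that `T` produces inside the sum is absorbed into the binomial coefficient and
  -- comes out as `n`.
  L-T : ∀ f n b → L (T f) n b ≡ T (L f) n b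
  L-T f zero    b = refl
  L-T f (suc n) b = bsum-absorbʳ n (λ k l → T f l (b ℕ.+ k)) (λ k l → f l (suc b ℕ.+ k)) (λ _ → refl) (λ _ _ → refl)

  -- Inside the sum the second argument is b + k; the part k is absorbed and yields `T`. At a = b +
  -- 1 the operator b + T is a - V, the form used in `Lₚ`.
  L-A : ∀ f n b → L (λ m a → + a * f m a) n b ≡ + b * L f n b + T (L f) n b
  L-A f n b = begin
    bsum n (λ k l → + (b ℕ.+ k) * f l (b ℕ.+ k))
      ≡⟨ bsum-cong n (λ k l _ → ℤₚ.*-distribʳ-+ (f l (b ℕ.+ k)) (+ b) (+ k)) ⟩
    bsum n (λ k l → + b * f l (b ℕ.+ k) + + k * f l (b ℕ.+ k))
      ≡⟨ bsum-+ n (λ k l → + b * f l (b ℕ.+ k)) (λ k l → + k * f l (b ℕ.+ k)) ⟩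
    bsum n (λ k l → + b * f l (b ℕ.+ k)) + bsum n (λ k l → + k * f l (b ℕ.+ k))
      ≡⟨ cong₂ _+_ (bsum-* n (+ b) (λ k l → f l (b ℕ.+ k))) (weighted n) ⟩
    + b * L f n b + T (L f) n b ∎
    where
    weighted : ∀ n → bsum n (λ k l → + k * f l (b ℕ.+ k)) ≡ T (L f) n b
    weighted zero    = refl
    weighted (suc n) = bsum-absorbˡ n (λ k l → + k * f l (b ℕ.+ k)) (λ k l → f l (suc b ℕ.+ k)) (λ _ → refl)
      (λ k l → cong (λ z → + suc k * f l z) (ℕₚ.+-suc b k))

  L-+ : ∀ f g n b → L (λ m a → f m a + g m a) n b ≡ L f n b + L g n b
  L-+ f g n b = bsum-+ n _ _

  V-harmonic : ∀ {f} → Harmonic f → Harmonic (V f)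
  V-harmonic {f} hf n b = begin
    bsum n (λ k l → f l (b ℕ.+ k) - T f l (b ℕ.+ k))
      ≡⟨ bsum-cong n (λ k l _ → cong (λ z → f l (b ℕ.+ k) + z) (ℤₚ.-1*i≡-i (T f l (b ℕ.+ k)))) ⟨
    bsum n (λ k l → f l (b ℕ.+ k) + (- (+ 1)) * T f l (b ℕ.+ k))
      ≡⟨ bsum-+ n _ _ ⟩
    L f n b + bsum n (λ k l → (- (+ 1)) * T f l (b ℕ.+ k))
      ≡⟨ cong₂ _+_ (hf n b) (trans (bsum-* n (- (+ 1)) _) (ℤₚ.-1*i≡-i _)) ⟩
    f n (suc b) - L (T f) n b
      ≡⟨ cong (λ z → f n (suc b) - z) (trans (L-T f n b) (T-L n)) ⟩
    V f n (suc b) ∎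
    where
    T-L : ∀ n → T (L f) n b ≡ T f n (suc b)
    T-L zero    = refl
    T-L (suc n) = cong (+ suc n *_) (hf n (suc b))

  -- In generating functions h j is n! [zⁿ] e^{a T(z)} / (1 - T(z))^{j+1} for the tree function T(z).
  h : ℕ → Fun
  h zero    n       a = (+ (n ℕ.+ a)) ^ n
  h (suc j) zero    a = h j zero a
  h (suc j) (suc n) a = h j (suc n) a + + suc n * h (suc j) n (suc a)

  V-h : ∀ j n a → V (h (suc j)) n a ≡ h j n a
  V-h j zero    a = ℤₚ.+-identityʳ _
  V-h j (suc n) a = lem (h j (suc n) a) _
    where
    lem : ∀ x y → x + y - y ≡ x
    lem = solve-∀

  -- For `h 0` the base l + (b + k) is the constant n + b, so the sum is a binomial expansion with 1
  -- as the other summand. Higher `h` inherit the property through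
  -- `h (suc j) = h j + T (h (suc j))`, as `L` commutes with `T`.
  h-harmonic : ∀ j → Harmonic (h j)
  h-harmonic zero n b = begin
    bsum n (λ k l → (+ (l ℕ.+ (b ℕ.+ k))) ^ l)
      ≡⟨ bsum-cong n (λ k l e → base k l e) ⟩
    bsum n (λ k l → (+ 1) ^ k * (+ (n ℕ.+ b)) ^ l)
      ≡⟨ binomial n (+ 1) (+ (n ℕ.+ b)) ⟩
    (+ (suc (n ℕ.+ b))) ^ n
      ≡⟨ cong (λ z → (+ z) ^ n) (ℕₚ.+-suc n b) ⟨
    (+ (n ℕ.+ suc b)) ^ n ∎
    where
    base : ∀ k l → k ℕ.+ l ≡ n → (+ (l ℕ.+ (b ℕ.+ k))) ^ l ≡ (+ 1) ^ k * (+ (n ℕ.+ b)) ^ l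
    base k l refl = trans (cong (λ z → (+ z) ^ l) idx)
      (sym (trans (cong (_* ((+ (k ℕ.+ l ℕ.+ b)) ^ l)) (ℤₚ.^-zeroˡ k)) (ℤₚ.*-identityˡ _)))
      where
      idx : l ℕ.+ (b ℕ.+ k) ≡ k ℕ.+ l ℕ.+ b
      idx = trans (cong (l ℕ.+_) (ℕₚ.+-comm b k)) (trans (sym (ℕₚ.+-assoc l k b)) (cong (ℕ._+ b) (ℕₚ.+-comm l k)))
  h-harmonic (suc j) zero    b = h-harmonic j zero b
  h-harmonic (suc j) (suc n) b = begin
    L (h (suc j)) (suc n) b
      ≡⟨ L-cong split (suc n) b ⟩
    L (λ m a → h j m a + T (h (suc j)) m a) (suc n) b
      ≡⟨ L-+ (h j) (T (h (suc j))) (suc n) b ⟩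
    L (h j) (suc n) b + L (T (h (suc j))) (suc n) b
      ≡⟨ cong₂ _+_ (h-harmonic j (suc n) b)
           (trans (L-T (h (suc j)) (suc n) b) (cong (+ suc n *_) (h-harmonic (suc j) n (suc b)))) ⟩
    h (suc j) (suc n) (suc b) ∎
    where
    split : ∀ m a → h (suc j) m a ≡ h j m a + T (h (suc j)) m a
    split zero    a = sym (ℤₚ.+-identityʳ _)
    split (suc m) a = refl

  -- Polynomials in A and V

  Row : Set
  Row = List ℤ

  -- Σ cᵢ Vⁱ
  evRow : Row → Fun → Fun
  evRow []       f n a = + 0
  evRow (c ∷ cs) f n a = c * f n a + evRow cs (V f) n a

  Poly : Set
  Poly = List Row

  -- Σ Aⁱ rᵢ(V) applied to f, where A is multiplication by a
  ev : Poly → Fun → Fun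
  ev []      f n a = + 0
  ev (r ∷ p) f n a = evRow r f n a + + a * ev p f n a

  infixl 6 _⊕_ _⊞_
  _⊞_ : Row → Row → Row
  []       ⊞ s        = s
  (c ∷ r)  ⊞ []       = c ∷ r
  (c ∷ r)  ⊞ (d ∷ s)  = c + d ∷ r ⊞ s

  _⊕_ : Poly → Poly → Poly
  []      ⊕ q       = q
  (r ∷ p) ⊕ []      = r ∷ p
  (r ∷ p) ⊕ (s ∷ q) = r ⊞ s ∷ p ⊕ q

  scale : ℤ → Poly → Poly
  scale c = map (map (c *_))

  neg : Poly → Poly
  neg = scale (- (+ 1))

  -- From T A = (A + 1) T follows V A = A V + V - 1, which moves `V` past each power of A. The
  -- recursive result enters twice, so `go` takes it as an argument.
  Vₚ : Poly → Poly
  Vₚ []      = []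
  Vₚ (r ∷ p) = go (Vₚ p)
    where
    go : Poly → Poly
    go q = ((+ 0 ∷ r) ∷ q) ⊕ (q ⊕ neg p)

  -- Meant for harmonic arguments: there `L` fixes each row, and L A = (A - V) L handles one power
  -- of A at a time.
  Lₚ : Poly → Poly
  Lₚ []      = []
  Lₚ (r ∷ p) = go (Lₚ p)
    where
    go : Poly → Poly
    go q = (r ∷ q) ⊕ neg (Vₚ q)

  evRow-cong : ∀ r {f g} → (∀ n a → f n a ≡ g n a) → ∀ n a → evRow r f n a ≡ evRow r g n a
  evRow-cong []      e n a = refl
  evRow-cong (c ∷ r) e n a = cong₂ _+_ (cong (c *_) (e n a)) (evRow-cong r (V-cong e) n a)

  evRow-⊞ : ∀ r s f n a → evRow (r ⊞ s) f n a ≡ evRow r f n a + evRow s f n a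
  evRow-⊞ []      s       f n a = sym (ℤₚ.+-identityˡ _)
  evRow-⊞ (c ∷ r) []      f n a = sym (ℤₚ.+-identityʳ _)
  evRow-⊞ (c ∷ r) (d ∷ s) f n a rewrite evRow-⊞ r s (V f) n a = lem c d (f n a) (evRow r (V f) n a) (evRow s (V f) n a)
    where
    lem : ∀ c d x y z → (c + d) * x + (y + z) ≡ (c * x + y) + (d * x + z)
    lem = solve-∀

  ev-⊕ : ∀ p q f n a → ev (p ⊕ q) f n a ≡ ev p f n a + ev q f n a
  ev-⊕ []      q       f n a = sym (ℤₚ.+-identityˡ _)
  ev-⊕ (r ∷ p) []      f n a = sym (ℤₚ.+-identityʳ _)
  ev-⊕ (r ∷ p) (s ∷ q) f n a rewrite evRow-⊞ r s f n a | ev-⊕ p q f n a =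
    lem (+ a) (evRow r f n a) (evRow s f n a) (ev p f n a) (ev q f n a)
    where
    lem : ∀ a x y z w → (x + y) + a * (z + w) ≡ (x + a * z) + (y + a * w)
    lem = solve-∀

  evRow-scale : ∀ c r f n a → evRow (map (c *_) r) f n a ≡ c * evRow r f n a
  evRow-scale c []      f n a = sym (ℤₚ.*-zeroʳ c)
  evRow-scale c (d ∷ r) f n a rewrite evRow-scale c r (V f) n a = lem c d _ _
    where
    lem : ∀ c d x y → c * d * x + c * y ≡ c * (d * x + y)
    lem = solve-∀

  ev-scale : ∀ c p f n a → ev (scale c p) f n a ≡ c * ev p f n a
  ev-scale c []      f n a = sym (ℤₚ.*-zeroʳ c)
  ev-scale c (r ∷ p) f n a rewrite evRow-scale c r f n a | ev-scale c p f n a = lem c (+ a) _ _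
    where
    lem : ∀ c a x y → c * x + a * (c * y) ≡ c * (x + a * y)
    lem = solve-∀

  ev-neg : ∀ p f n a → ev (neg p) f n a ≡ - ev p f n a
  ev-neg p f n a = trans (ev-scale (- + 1) p f n a) (ℤₚ.-1*i≡-i _)

  T-A : ∀ f n a → T (λ n a → + a * f n a) n a ≡ + suc a * T f n a
  T-A f zero    a = sym (ℤₚ.*-zeroʳ (+ suc a))
  T-A f (suc n) a = lem (+ suc n) (+ suc a) _
    where
    lem : ∀ s a x → s * (a * x) ≡ a * (s * x)
    lem = solve-∀

  V-+ : ∀ f g n a → V (λ n a → f n a + g n a) n a ≡ V f n a + V g n a
  V-+ f g zero    a = lem (f 0 a) (g 0 a)
    where
    lem : ∀ x y → x + y - + 0 ≡ (x - + 0) + (y - + 0)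
    lem = solve-∀
  V-+ f g (suc n) a = lem (+ suc n) (f (suc n) a) (g (suc n) a) (f n (suc a)) (g n (suc a))
    where
    lem : ∀ s x y x′ y′ → x + y - s * (x′ + y′) ≡ (x - s * x′) + (y - s * y′)
    lem = solve-∀

  V-* : ∀ c f n a → V (λ n a → c * f n a) n a ≡ c * V f n a
  V-* c f zero    a = lem c _
    where
    lem : ∀ c x → c * x - + 0 ≡ c * (x - + 0)
    lem = solve-∀
  V-* c f (suc n) a = lem (+ suc n) c _ _
    where
    lem : ∀ s c x y → c * x - s * (c * y) ≡ c * (x - s * y)
    lem = solve-∀

  V-A : ∀ f n a → V (λ n a → + a * f n a) n a ≡ + a * V f n a + (V f n a - f n a)
  V-A f n a rewrite T-A f n a = lem (+ a) (f n a) (T f n a)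
    where
    lem : ∀ a x y → a * x - (+ 1 + a) * y ≡ a * (x - y) + ((x - y) - x)
    lem = solve-∀

  evRow-V : ∀ r f n a → V (evRow r f) n a ≡ evRow r (V f) n a
  evRow-V []      f zero    a = refl
  evRow-V []      f (suc n) a = cong (λ z → + 0 - z) (ℤₚ.*-zeroʳ (+ suc n))
  evRow-V (c ∷ r) f n a = begin
    V (λ n a → c * f n a + evRow r (V f) n a) n a
      ≡⟨ V-+ (λ n a → c * f n a) (evRow r (V f)) n a ⟩
    V (λ n a → c * f n a) n a + V (evRow r (V f)) n a
      ≡⟨ cong₂ _+_ (V-* c f n a) (evRow-V r (V f) n a) ⟩
    evRow (c ∷ r) (V f) n a ∎

  ev-Vₚ : ∀ p f n a → ev (Vₚ p) f n a ≡ V (ev p f) n a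
  ev-Vₚ []      f zero    a = refl
  ev-Vₚ []      f (suc n) a = sym (cong (λ z → + 0 - z) (ℤₚ.*-zeroʳ (+ suc n)))
  ev-Vₚ (r ∷ p) f n a = begin
    ev (((+ 0 ∷ r) ∷ Vₚ p) ⊕ (Vₚ p ⊕ neg p)) f n a
      ≡⟨ ev-⊕ ((+ 0 ∷ r) ∷ Vₚ p) (Vₚ p ⊕ neg p) f n a ⟩
    + 0 * f n a + evRow r (V f) n a + + a * ev (Vₚ p) f n a + ev (Vₚ p ⊕ neg p) f n a
      ≡⟨ cong₂ _+_ (cong₂ _+_ (trans (ℤₚ.+-identityˡ _) (sym (evRow-V r f n a)))
                              (cong (+ a *_) (ev-Vₚ p f n a)))
                   (trans (ev-⊕ (Vₚ p) (neg p) f n a) (cong₂ _+_ (ev-Vₚ p f n a) (ev-neg p f n a))) ⟩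
    V (evRow r f) n a + + a * V (ev p f) n a + (V (ev p f) n a - ev p f n a)
      ≡⟨ ℤₚ.+-assoc (V (evRow r f) n a) _ _ ⟩
    V (evRow r f) n a + (+ a * V (ev p f) n a + (V (ev p f) n a - ev p f n a))
      ≡⟨ cong (λ z → V (evRow r f) n a + z) (V-A (ev p f) n a) ⟨
    V (evRow r f) n a + V (λ n a → + a * ev p f n a) n a
      ≡⟨ V-+ (evRow r f) (λ n a → + a * ev p f n a) n a ⟨
    V (ev (r ∷ p) f) n a ∎

  evRow-harmonic : ∀ r {f} → Harmonic f → Harmonic (evRow r f)
  evRow-harmonic []      hf n b = trans (bsum-* n (+ 0) (λ _ _ → + 0)) refl
  evRow-harmonic (c ∷ r) {f} hf n b = begin
    L (λ n a → c * f n a + evRow r (V f) n a) n b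
      ≡⟨ L-+ (λ n a → c * f n a) (evRow r (V f)) n b ⟩
    L (λ n a → c * f n a) n b + L (evRow r (V f)) n b
      ≡⟨ cong₂ _+_ (trans (bsum-* n c _) (cong (c *_) (hf n b)))
                   (evRow-harmonic r (V-harmonic {f} hf) n b) ⟩
    evRow (c ∷ r) f n (suc b) ∎

  ev-Lₚ : ∀ p {f} → Harmonic f → ∀ n b → ev (Lₚ p) f n (suc b) ≡ L (ev p f) n b
  ev-Lₚ []      hf n b = sym (bsum-* n (+ 0) (λ _ _ → + 0))
  ev-Lₚ (r ∷ p) {f} hf n b = begin
    ev ((r ∷ Lₚ p) ⊕ neg (Vₚ (Lₚ p))) f n (suc b)
      ≡⟨ ev-⊕ (r ∷ Lₚ p) (neg (Vₚ (Lₚ p))) f n (suc b) ⟩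
    evRow r f n (suc b) + + suc b * q n (suc b) + ev (neg (Vₚ (Lₚ p))) f n (suc b)
      ≡⟨ cong (λ z → evRow r f n (suc b) + + suc b * q n (suc b) + z)
              (trans (ev-neg (Vₚ (Lₚ p)) f n (suc b)) (cong -_ (ev-Vₚ (Lₚ p) f n (suc b)))) ⟩
    evRow r f n (suc b) + + suc b * q n (suc b) - V q n (suc b)
      ≡⟨ lem (evRow r f n (suc b)) (+ b) (q n (suc b)) (T q n (suc b)) ⟩
    evRow r f n (suc b) + (+ b * q n (suc b) + T q n (suc b))
      ≡⟨ cong₂ (λ x y → x + (+ b * y + T q n (suc b))) (sym (evRow-harmonic r {f} hf n b)) (ev-Lₚ p {f} hf n b) ⟩
    L (evRow r f) n b + (+ b * L (ev p f) n b + T q n (suc b))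
      ≡⟨ cong (λ z → L (evRow r f) n b + (+ b * L (ev p f) n b + z)) (T-q n) ⟩
    L (evRow r f) n b + (+ b * L (ev p f) n b + T (L (ev p f)) n b)
      ≡⟨ cong (λ z → L (evRow r f) n b + z) (L-A (ev p f) n b) ⟨
    L (evRow r f) n b + L (λ n a → + a * ev p f n a) n b
      ≡⟨ L-+ (evRow r f) (λ n a → + a * ev p f n a) n b ⟨
    L (ev (r ∷ p) f) n b ∎
    where
    q : Fun
    q = ev (Lₚ p) f
    T-q : ∀ n → T q n (suc b) ≡ T (L (ev p f)) n b
    T-q zero    = refl
    T-q (suc n) = cong (+ suc n *_) (ev-Lₚ p hf n (suc b))
    lem : ∀ r b x t → r + (+ 1 + b) * x - (x - t) ≡ r + (b * x + t)
    lem = solve-∀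

  -- Multiplication by the falling factorial (a - 1)(a - 2) ⋯ (a - s).
  shiftFall : ℕ → Poly → Poly
  shiftFall zero    p = p
  shiftFall (suc s) p = go (shiftFall s p)
    where
    go : Poly → Poly
    go q = ([] ∷ q) ⊕ scale (- + suc s) q

  bsumₚ : ℕ → (ℕ → ℕ → Poly) → Poly
  bsumₚ zero    g = g 0 0
  bsumₚ (suc n) g = bsumₚ n (λ k l → g (suc k) l) ⊕ bsumₚ n (λ k l → g k (suc l))

  ev-bsumₚ : ∀ r g f n a → ev (bsumₚ r g) f n a ≡ bsum r (λ s t → ev (g s t) f n a)
  ev-bsumₚ zero    g f n a = refl
  ev-bsumₚ (suc r) g f n a = trans (ev-⊕ (bsumₚ r _) _ f n a)
    (cong₂ _+_ (ev-bsumₚ r _ f n a) (ev-bsumₚ r _ f n a))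

  isZeroRow : Row → Bool
  isZeroRow []           = true
  isZeroRow (+ 0 ∷ r)    = isZeroRow r
  isZeroRow (_ ∷ r)      = false

  isZero : Poly → Bool
  isZero []      = true
  isZero (r ∷ p) = isZeroRow r ∧ isZero p

  evRow-isZero : ∀ r → isZeroRow r ≡ true → ∀ f n a → evRow r f n a ≡ + 0
  evRow-isZero []        _ f n a = refl
  evRow-isZero (+ 0 ∷ r) e f n a = trans (ℤₚ.+-identityˡ _) (evRow-isZero r e (V f) n a)

  ev-isZero : ∀ p → isZero p ≡ true → ∀ f n a → ev p f n a ≡ + 0
  ev-isZero []      _ f n a = refl
  ev-isZero (r ∷ p) e f n a with isZeroRow r in e₁
  ... | true = trans (cong₂ _+_ (evRow-isZero r e₁ f n a)
                                (trans (cong (+ a *_) (ev-isZero p e f n a)) (ℤₚ.*-zeroʳ (+ a)))) refl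

  -- With h (-1) = V (h 0), the coefficients cs of h (-1), h 0, h 1, … as an operator on h 10.
  row : List ℤ → Row
  row cs = replicate (12 ℕ.∸ length cs) (+ 0) ++ reverse cs

  -- 240 times the r-th factorial moment sum, found by solving the recurrence degree by degree in A:
  -- L Aⁱ h (j + 1) = Aⁱ h (j + 1) - i Aⁱ⁻¹ h j + terms of lower degree in A.
  momentPoly : ℕ → Poly
  momentPoly 0 =
      ( row (+ 240 ∷ [])
      ∷ [])
  momentPoly 1 =
      ( []
      ∷ row (+ 120 ∷ - + 360 ∷ + 120 ∷ [])
      ∷ row (+ 0 ∷ + 120 ∷ [])
      ∷ [])
  momentPoly 2 =
      ( []
      ∷ row (- + 100 ∷ + 340 ∷ - + 640 ∷ + 1280 ∷ - + 1060 ∷ + 300 ∷ [])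
      ∷ row (+ 60 ∷ - + 480 ∷ + 1020 ∷ - + 960 ∷ + 300 ∷ [])
      ∷ row (+ 0 ∷ + 120 ∷ - + 440 ∷ + 200 ∷ [])
      ∷ row (+ 0 ∷ + 0 ∷ + 60 ∷ [])
      ∷ [])
  momentPoly 3 =
      ( []
      ∷ row (+ 180 ∷ - + 660 ∷ + 1710 ∷ - + 5130 ∷ + 11940 ∷ - + 21240 ∷ + 22710 ∷ - + 12450 ∷ + 2700 ∷ [])
      ∷ row (- + 150 ∷ + 1200 ∷ - + 3690 ∷ + 8640 ∷ - + 16350 ∷ + 19260 ∷ - + 11550 ∷ + 2700 ∷ [])
      ∷ row (+ 30 ∷ - + 600 ∷ + 2730 ∷ - + 5970 ∷ + 8940 ∷ - + 6600 ∷ + 1800 ∷ [])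
      ∷ row (+ 0 ∷ + 90 ∷ - + 840 ∷ + 2130 ∷ - + 2220 ∷ + 750 ∷ [])
      ∷ row (+ 0 ∷ + 0 ∷ + 90 ∷ - + 390 ∷ + 210 ∷ [])
      ∷ row (+ 0 ∷ + 0 ∷ + 0 ∷ + 30 ∷ [])
      ∷ [])
  momentPoly 4 =
      ( []
      ∷ row (- + 502 ∷ + 1942 ∷ - + 5905 ∷ + 21305 ∷ - + 67492 ∷ + 186804 ∷ - + 422802 ∷ + 740130 ∷ - + 897470 ∷ + 678110 ∷ - + 283125 ∷ + 49725 ∷ [])
      ∷ row (+ 485 ∷ - + 3970 ∷ + 14565 ∷ - + 45900 ∷ + 130670 ∷ - + 305160 ∷ + 561870 ∷ - + 731780 ∷ + 595985 ∷ - + 266550 ∷ + 49725 ∷ [])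
      ∷ row (- + 150 ∷ + 2550 ∷ - + 13330 ∷ + 42650 ∷ - + 111760 ∷ + 228460 ∷ - + 340250 ∷ + 318190 ∷ - + 160650 ∷ + 33150 ∷ [])
      ∷ row (+ 15 ∷ - + 660 ∷ + 5750 ∷ - + 21700 ∷ + 53605 ∷ - + 96180 ∷ + 108030 ∷ - + 63500 ∷ + 14775 ∷ [])
      ∷ row (+ 0 ∷ + 60 ∷ - + 1170 ∷ + 6270 ∷ - + 15588 ∷ + 23568 ∷ - + 17490 ∷ + 4830 ∷ [])
      ∷ row (+ 0 ∷ + 0 ∷ + 90 ∷ - + 960 ∷ + 2810 ∷ - + 3160 ∷ + 1130 ∷ [])
      ∷ row (+ 0 ∷ + 0 ∷ + 0 ∷ + 60 ∷ - + 300 ∷ + 180 ∷ [])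
      ∷ row (+ 0 ∷ + 0 ∷ + 0 ∷ + 0 ∷ + 15 ∷ [])
      ∷ [])
  momentPoly _ = []

  -- The binomial sum comes from the Vandermonde expansion of the falling factorial of (a - 1) + z,
  -- with z the area left after the deletion; `shiftFall s` is the factor belonging to a - 1.
  recurrence : ℕ → Poly
  recurrence r = bsumₚ r (λ s t → shiftFall s (Lₚ (momentPoly t))) ⊕ neg (momentPoly r)

  -- Falling factorials and sums over vectors

  ff : ℕ → ℤ → ℤ
  ff zero    z = + 1
  ff (suc r) z = z * ff r (z - + 1)

  -- Splitting the leading factor x + y lowers either x or y by one, which is the Pascal step of
  -- `bsum`.
  vandermonde : ∀ r x y → ff r (x + y) ≡ bsum r (λ s t → ff s x * ff t y)
  vandermonde zero    x y = refl
  vandermonde (suc r) x y = begin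
    (x + y) * ff r (x + y - + 1)
      ≡⟨ ℤₚ.*-distribʳ-+ (ff r (x + y - + 1)) x y ⟩
    x * ff r (x + y - + 1) + y * ff r (x + y - + 1)
      ≡⟨ cong₂ (λ u v → x * ff r u + y * ff r v) (lem₁ x y) (ℤₚ.+-assoc x y (- + 1)) ⟩
    x * ff r (x - + 1 + y) + y * ff r (x + (y - + 1))
      ≡⟨ cong₂ (λ u v → x * u + y * v) (vandermonde r (x - + 1) y) (vandermonde r x (y - + 1)) ⟩
    x * bsum r (λ s t → ff s (x - + 1) * ff t y) + y * bsum r (λ s t → ff s x * ff t (y - + 1))
      ≡⟨ cong₂ _+_ (bsum-* r x (λ s t → ff s (x - + 1) * ff t y))
                   (bsum-* r y (λ s t → ff s x * ff t (y - + 1))) ⟨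
    bsum r (λ s t → x * (ff s (x - + 1) * ff t y)) + bsum r (λ s t → y * (ff s x * ff t (y - + 1)))
      ≡⟨ cong₂ _+_ (bsum-cong r λ s t _ → sym (ℤₚ.*-assoc x (ff s (x - + 1)) (ff t y)))
                   (bsum-cong r λ s t _ → lem₂ y (ff s x) (ff t (y - + 1))) ⟩
    bsum (suc r) (λ s t → ff s x * ff t y) ∎
    where
    lem₁ : ∀ x y → x + y - + 1 ≡ x - + 1 + y
    lem₁ = solve-∀
    lem₂ : ∀ y p q → y * (p * q) ≡ p * (y * q)
    lem₂ = solve-∀

  rangeSum : ℕ → (ℕ → ℤ) → ℤ
  rangeSum zero    g = + 0
  rangeSum (suc m) g = g 0 + rangeSum m (λ i → g (suc i))

  vecSum : ℕ → ℕ → (List ℕ → ℤ) → ℤ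
  vecSum m zero    g = g []
  vecSum m (suc n) g = vecSum m n (λ v → rangeSum m (λ i → g (i ∷ v)))

  record Linear {X : Set} (Φ : (X → ℤ) → ℤ) : Set where
    field
      ext : ∀ {f g} → (∀ x → f x ≡ g x) → Φ f ≡ Φ g
      add  : ∀ f g → Φ (λ x → f x + g x) ≡ Φ f + Φ g
      mul  : ∀ c f → Φ (λ x → c * f x) ≡ c * Φ f
  open Linear

  rangeSum-linear : ∀ m → Linear (rangeSum m)
  rangeSum-linear zero    = record { ext = λ _ → refl ; add = λ _ _ → refl ; mul = λ c _ → sym (ℤₚ.*-zeroʳ c) }
  rangeSum-linear (suc m) = record
    { ext = λ e → cong₂ _+_ (e 0) (ext ih (λ i → e (suc i)))
    ; add  = λ f g → trans (cong (λ z → f 0 + g 0 + z) (add ih (λ i → f (suc i)) (λ i → g (suc i))))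
                           (lem (f 0) (g 0) (rangeSum m (λ i → f (suc i))) (rangeSum m (λ i → g (suc i))))
    ; mul  = λ c f → trans (cong (λ z → c * f 0 + z) (mul ih c (λ i → f (suc i)))) (sym (ℤₚ.*-distribˡ-+ c (f 0) _)) }
    where
    ih = rangeSum-linear m
    lem : ∀ a b x y → a + b + (x + y) ≡ a + x + (b + y)
    lem = solve-∀

  vecSum-linear : ∀ m n → Linear (vecSum m n)
  vecSum-linear m zero    = record { ext = λ e → e [] ; add = λ _ _ → refl ; mul = λ _ _ → refl }
  vecSum-linear m (suc n) = record
    { ext = λ e → ext (vecSum-linear m n) (λ v → ext r (λ i → e (i ∷ v)))
    ; add  = λ f g → trans (ext (vecSum-linear m n) (λ v → add r (λ i → f (i ∷ v)) (λ i → g (i ∷ v))))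
                           (add (vecSum-linear m n) (λ v → rangeSum m (λ i → f (i ∷ v))) (λ v → rangeSum m (λ i → g (i ∷ v))))
    ; mul  = λ c f → trans (ext (vecSum-linear m n) (λ v → mul r c (λ i → f (i ∷ v))))
                           (mul (vecSum-linear m n) c (λ v → rangeSum m (λ i → f (i ∷ v)))) }
    where r = rangeSum-linear m

  linear-bsum : ∀ {X : Set} {Φ : (X → ℤ) → ℤ} → Linear Φ → ∀ r (g : ℕ → ℕ → X → ℤ) →
                Φ (λ x → bsum r (λ s t → g s t x)) ≡ bsum r (λ s t → Φ (g s t))
  linear-bsum lin zero    g = refl
  linear-bsum lin (suc r) g = trans
    (add lin (λ x → bsum r (λ s t → g (suc s) t x)) (λ x → bsum r (λ s t → g s (suc t) x)))
    (cong₂ _+_ (linear-bsum lin r (λ s t → g (suc s) t)) (linear-bsum lin r (λ s t → g s (suc t))))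

  -- Deleting the zeros of a vector

  zeros : List ℕ → ℕ
  zeros []          = 0
  zeros (zero ∷ v)  = suc (zeros v)
  zeros (suc _ ∷ v) = zeros v

  preds : List ℕ → List ℕ
  preds []          = []
  preds (zero ∷ v)  = preds v
  preds (suc i ∷ v) = i ∷ preds v

  -- Each entry is either zero, which raises k, or positive, which lengthens the remaining vector.
  -- This is the recursion of `bsum`, whose weights thus count the positions of the zeros.
  vecSum-split : ∀ m n (H : ℕ → List ℕ → ℤ) →
                 vecSum (suc m) n (λ v → H (zeros v) (preds v)) ≡ bsum n (λ k l → vecSum m l (H k))
  vecSum-split m zero    H = refl
  vecSum-split m (suc n) H = begin
    vecSum (suc m) n (λ v → H (suc (zeros v)) (preds v) + H₂ (zeros v) (preds v))
      ≡⟨ add (vecSum-linear (suc m) n) (λ v → H (suc (zeros v)) (preds v)) (λ v → H₂ (zeros v) (preds v)) ⟩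
    vecSum (suc m) n (λ v → H (suc (zeros v)) (preds v)) + vecSum (suc m) n (λ v → H₂ (zeros v) (preds v))
      ≡⟨ cong₂ _+_ (vecSum-split m n (λ k → H (suc k))) (vecSum-split m n H₂) ⟩
    bsum (suc n) (λ k l → vecSum m l (H k)) ∎
    where
    H₂ : ℕ → List ℕ → ℤ
    H₂ k q = rangeSum m (λ i → H k (i ∷ q))

  -- The parking condition for entries counted from 0, with first bound i.
  fits : ℕ → List ℕ → Bool
  fits i []      = true
  fits i (x ∷ w) = (x <ᵇ i) ∧ fits (suc i) w

  fits-zeros : ∀ a k w → fits (suc a) (replicate k 0 ++ w) ≡ fits (suc a ℕ.+ k) w
  fits-zeros a zero    w = cong (λ i → fits i w) (sym (ℕₚ.+-identityʳ (suc a)))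
  fits-zeros a (suc k) w = trans (fits-zeros (suc a) k w) (cong (λ i → fits i w) (sym (ℕₚ.+-suc (suc a) k)))

  fits-suc : ∀ a w → fits (suc a) (map suc w) ≡ fits a w
  fits-suc a []      = refl
  fits-suc a (x ∷ w) = cong ((x <ᵇ a) ∧_) (fits-suc (suc a) w)

  ≤ᵇ-suc : ∀ x y → (suc x ≤ᵇ suc y) ≡ (x ≤ᵇ y)
  ≤ᵇ-suc zero    y = refl
  ≤ᵇ-suc (suc x) y = refl

  insert-suc : ∀ x k w → insert (suc x) (replicate k 0 ++ map suc w) ≡ replicate k 0 ++ map suc (insert x w)
  insert-suc x zero    []      = refl
  insert-suc x zero    (y ∷ w) rewrite ≤ᵇ-suc x y with x ≤ᵇ y
  ... | true  = refl
  ... | false = cong (suc y ∷_) (insert-suc x zero w)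
  insert-suc x (suc k) w       = cong (0 ∷_) (insert-suc x k w)

  insert-zero : ∀ w → insert 0 w ≡ 0 ∷ w
  insert-zero []      = refl
  insert-zero (x ∷ w) = refl

  sort-split : ∀ v → sort v ≡ replicate (zeros v) 0 ++ map suc (sort (preds v))
  sort-split []          = refl
  sort-split (zero ∷ v)  = trans (insert-zero (sort v)) (cong (0 ∷_) (sort-split v))
  sort-split (suc x ∷ v) = trans (cong (insert (suc x)) (sort-split v)) (insert-suc x (zeros v) (sort (preds v)))

  sort-suc : ∀ v → sort (map suc v) ≡ map suc (sort v)
  sort-suc []      = refl
  sort-suc (x ∷ v) = trans (cong (insert (suc x)) (sort-suc v)) (insert-suc x 0 (sort v))

  -- In sorted order the zeros come first and each raises the next bound by one; lowering the
  -- remaining entries by one then takes one off the bound.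
  fits-split : ∀ a v → fits (suc a) (sort v) ≡ fits (a ℕ.+ zeros v) (sort (preds v))
  fits-split a v = begin
    fits (suc a) (sort v)                                                      ≡⟨ cong (fits (suc a)) (sort-split v) ⟩
    fits (suc a) (replicate (zeros v) 0 ++ map suc (sort (preds v)))           ≡⟨ fits-zeros a (zeros v) (map suc (sort (preds v))) ⟩
    fits (suc a ℕ.+ zeros v) (map suc (sort (preds v)))                        ≡⟨ fits-suc (a ℕ.+ zeros v) (sort (preds v)) ⟩
    fits (a ℕ.+ zeros v) (sort (preds v))                                      ∎

  fits-none : ∀ x v → fits 0 (sort (x ∷ v)) ≡ false
  fits-none x v = lem (sort v)
    where
    lem : ∀ w → fits 0 (insert x w) ≡ false
    lem []      = refl
    lem (y ∷ w) with x ≤ᵇ y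
    ... | true  = refl
    ... | false = refl

  tri : ℕ → ℕ
  tri zero    = 0
  tri (suc n) = n ℕ.+ tri n

  -- For a = 1 this is the area; in general it is shifted by C(a,2), which simplifies the recurrence.
  areaℤ : ℕ → List ℕ → ℤ
  areaℤ a v = + tri (length v ℕ.+ a) - + length v - + sumℕ v

  length-split : ∀ v → length v ≡ length (preds v) ℕ.+ zeros v
  length-split []          = refl
  length-split (zero ∷ v)  = trans (cong suc (length-split v)) (sym (ℕₚ.+-suc (length (preds v)) (zeros v)))
  length-split (suc x ∷ v) = cong suc (length-split v)

  sum-split : ∀ v → sumℕ v ≡ length (preds v) ℕ.+ sumℕ (preds v)
  sum-split []          = refl
  sum-split (zero ∷ v)  = sum-split v
  sum-split (suc x ∷ v) = cong suc (trans (cong (x ℕ.+_) (sum-split v)) (lem x (length (preds v)) (sumℕ (preds v))))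
    where
    lem : ∀ x l s → x ℕ.+ (l ℕ.+ s) ≡ l ℕ.+ (x ℕ.+ s)
    lem x l s = trans (sym (ℕₚ.+-assoc x l s)) (trans (cong (ℕ._+ s) (ℕₚ.+-comm x l)) (ℕₚ.+-assoc l x s))

  -- Going from a to a + 1 raises the triangular number by `length v + a`. Here `length v` cancels
  -- the subtracted length, and lowering the nonzero entries removes `length (preds v)` from the
  -- sum, the length term wanted for `preds v`. Only `a` is left over, independent of `v`.
  areaℤ-split : ∀ a v → areaℤ (suc a) v ≡ + a + areaℤ (a ℕ.+ zeros v) (preds v)
  areaℤ-split a v = begin
    + tri (length v ℕ.+ suc a) - + length v - + sumℕ v
      ≡⟨ cong (λ z → + tri z - + length v - + sumℕ v) (ℕₚ.+-suc (length v) a) ⟩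
    + length v + + a + + tri (length v ℕ.+ a) - + length v - + sumℕ v
      ≡⟨ cong₂ (λ y z → + length v + + a + + tri y - + length v - + z) idx (sum-split v) ⟩
    + length v + + a + + tri y - + length v - (+ length (preds v) + + sumℕ (preds v))
      ≡⟨ lem (+ length v) (+ a) (+ tri y) (+ length (preds v)) (+ sumℕ (preds v)) ⟩
    + a + (+ tri y - + length (preds v) - + sumℕ (preds v)) ∎
    where
    y = length (preds v) ℕ.+ (a ℕ.+ zeros v)
    idx : length v ℕ.+ a ≡ y
    idx = trans (cong (ℕ._+ a) (length-split v)) (trans (ℕₚ.+-assoc (length (preds v)) (zeros v) a)
            (cong (length (preds v) ℕ.+_) (ℕₚ.+-comm (zeros v) a)))
    lem : ∀ l a t p s → l + a + t - l - (p + s) ≡ a + (t - p - s)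
    lem = solve-∀

  -- The recurrence for the moment sums

  weight : ℕ → ℕ → List ℕ → ℤ
  weight r a v = if fits a (sort v) then ff r (areaℤ a v) else + 0

  -- The entries are counted from 0 and lie below m.
  momentSum : ℕ → ℕ → Fun
  momentSum m r n a = vecSum m n (weight r a)

  weight-split : ∀ r a v → weight r (suc a) v ≡
    bsum r (λ s t → ff s (+ a) * weight t (a ℕ.+ zeros v) (preds v))
  weight-split r a v rewrite fits-split a v with fits (a ℕ.+ zeros v) (sort (preds v))
  ... | true  = trans (cong (ff r) (areaℤ-split a v)) (vandermonde r (+ a) (areaℤ (a ℕ.+ zeros v) (preds v)))
  ... | false = sym (trans (bsum-cong r (λ s t _ → ℤₚ.*-zeroʳ (ff s (+ a)))) (bsum-* r (+ 0) (λ _ _ → + 0)))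

  momentSum-rec : ∀ m r n a → momentSum (suc m) r n (suc a) ≡ bsum r (λ s t → ff s (+ a) * L (momentSum m t) n a)
  momentSum-rec m r n a = begin
    vecSum (suc m) n (weight r (suc a))
      ≡⟨ ext (vecSum-linear (suc m) n) (weight-split r a) ⟩
    vecSum (suc m) n (λ v → bsum r (λ s t → ff s (+ a) * weight t (a ℕ.+ zeros v) (preds v)))
      ≡⟨ linear-bsum (vecSum-linear (suc m) n) r (λ s t v → ff s (+ a) * weight t (a ℕ.+ zeros v) (preds v)) ⟩
    bsum r (λ s t → vecSum (suc m) n (λ v → ff s (+ a) * weight t (a ℕ.+ zeros v) (preds v)))
      ≡⟨ bsum-cong r (λ s t _ → trans
           (mul (vecSum-linear (suc m) n) (ff s (+ a)) (λ v → weight t (a ℕ.+ zeros v) (preds v)))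
           (cong (ff s (+ a) *_) (vecSum-split m n (λ k → weight t (a ℕ.+ k))))) ⟩
    bsum r (λ s t → ff s (+ a) * L (momentSum m t) n a) ∎

  linear-zero : ∀ {X : Set} {Φ : (X → ℤ) → ℤ} → Linear Φ → ∀ {f} → (∀ x → f x ≡ + 0) → Φ f ≡ + 0
  linear-zero lin e = trans (ext lin e) (mul lin (+ 0) (λ _ → + 0))

  momentSum-none : ∀ m r n → momentSum m r (suc n) 0 ≡ + 0
  momentSum-none m r n = linear-zero (vecSum-linear m n) λ v → linear-zero (rangeSum-linear m) λ i →
    cong (λ b → if b then ff r (areaℤ 0 (i ∷ v)) else + 0) (fits-none i v)

  -- Closed forms of the moment sums

  U : Fun
  U = h 10

  closedForm : ℕ → Fun
  closedForm r = ev (momentPoly r) U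

  ev-shiftFall : ∀ s p f n b → ev (shiftFall s p) f n (suc b) ≡ ff s (+ b) * ev p f n (suc b)
  ev-shiftFall zero    p f n b = sym (ℤₚ.*-identityˡ _)
  ev-shiftFall (suc s) p f n b = begin
    ev (([] ∷ q) ⊕ scale (- + suc s) q) f n (suc b)
      ≡⟨ ev-⊕ ([] ∷ q) (scale (- + suc s) q) f n (suc b) ⟩
    + 0 + + suc b * ev q f n (suc b) + ev (scale (- + suc s) q) f n (suc b)
      ≡⟨ cong (λ z → + 0 + + suc b * ev q f n (suc b) + z) (ev-scale (- + suc s) q f n (suc b)) ⟩
    + 0 + + suc b * ev q f n (suc b) + (- + suc s) * ev q f n (suc b)
      ≡⟨ lem₁ (+ b) (+ s) (ev q f n (suc b)) ⟩
    (+ b - + s) * ev q f n (suc b)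
      ≡⟨ cong ((+ b - + s) *_) (ev-shiftFall s p f n b) ⟩
    (+ b - + s) * (ff s (+ b) * ev p f n (suc b))
      ≡⟨ lem₂ (+ b - + s) (ff s (+ b)) (ev p f n (suc b)) ⟩
    ff s (+ b) * (+ b - + s) * ev p f n (suc b)
      ≡⟨ cong (_* ev p f n (suc b)) (ff-last s (+ b)) ⟨
    ff (suc s) (+ b) * ev p f n (suc b) ∎
    where
    q = shiftFall s p
    lem₁ : ∀ b s x → + 0 + (+ 1 + b) * x + (- (+ 1 + s)) * x ≡ (b - s) * x
    lem₁ = solve-∀
    lem₂ : ∀ u v x → u * (v * x) ≡ v * u * x
    lem₂ = solve-∀
    ff-last : ∀ s z → ff (suc s) z ≡ ff s z * (z - + s)
    ff-last zero    z = trans (ℤₚ.*-identityʳ z) (sym (trans (ℤₚ.*-identityˡ (z - + 0)) (ℤₚ.+-identityʳ z)))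
    ff-last (suc s) z = trans (cong (z *_) (ff-last s (z - + 1))) (lem₃ z (ff s (z - + 1)) (+ s))
      where
      lem₃ : ∀ z x s → z * (x * (z - + 1 - s)) ≡ z * x * (z - (+ 1 + s))
      lem₃ = solve-∀

  closedForm-rec : ∀ r → isZero (recurrence r) ≡ true → ∀ n a →
          closedForm r n (suc a) ≡ bsum r (λ s t → ff s (+ a) * L (closedForm t) n a)
  closedForm-rec r e n a = begin
    closedForm r n (suc a)
      ≡⟨ ℤₚ.+-identityˡ _ ⟨
    + 0 + closedForm r n (suc a)
      ≡⟨ cong (λ z → z + closedForm r n (suc a)) (ev-isZero (recurrence r) e U n (suc a)) ⟨
    ev (rhs ⊕ neg (momentPoly r)) U n (suc a) + closedForm r n (suc a)
      ≡⟨ cong (λ z → z + closedForm r n (suc a))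
           (trans (ev-⊕ rhs (neg (momentPoly r)) U n (suc a)) (cong (λ z → ev rhs U n (suc a) + z) (ev-neg (momentPoly r) U n (suc a)))) ⟩
    ev rhs U n (suc a) - closedForm r n (suc a) + closedForm r n (suc a)
      ≡⟨ lem (ev rhs U n (suc a)) (closedForm r n (suc a)) ⟩
    ev rhs U n (suc a)
      ≡⟨ ev-bsumₚ r (λ s t → shiftFall s (Lₚ (momentPoly t))) U n (suc a) ⟩
    bsum r (λ s t → ev (shiftFall s (Lₚ (momentPoly t))) U n (suc a))
      ≡⟨ bsum-cong r (λ s t _ → trans (ev-shiftFall s (Lₚ (momentPoly t)) U n a)
           (cong (ff s (+ a) *_) (ev-Lₚ (momentPoly t) (h-harmonic 10) n a))) ⟩
    bsum r (λ s t → ff s (+ a) * L (closedForm t) n a) ∎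
    where
    rhs = bsumₚ r (λ s t → shiftFall s (Lₚ (momentPoly t)))
    lem : ∀ x y → x - y + y ≡ x
    lem = solve-∀

  recurrence-zero : ∀ r → r ℕ.≤ 4 → isZero (recurrence r) ≡ true
  recurrence-zero 0 _ = refl
  recurrence-zero 1 _ = refl
  recurrence-zero 2 _ = refl
  recurrence-zero 3 _ = refl
  recurrence-zero 4 _ = refl
  recurrence-zero (suc (suc (suc (suc (suc r))))) (ℕ.s≤s (ℕ.s≤s (ℕ.s≤s (ℕ.s≤s ()))))

  evRow-V^ : ∀ k j cs n a → evRow (replicate k (+ 0) ++ cs) (h (k ℕ.+ j)) n a ≡ evRow cs (h j) n a
  evRow-V^ zero    j cs n a = refl
  evRow-V^ (suc k) j cs n a = trans (ℤₚ.+-identityˡ _)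
    (trans (evRow-cong (replicate k (+ 0) ++ cs) (V-h (k ℕ.+ j)) n a) (evRow-V^ k j cs n a))

  closedForm-0 : ∀ n a → closedForm 0 n a ≡ + 240 * V (h 0) n a
  closedForm-0 n a = begin
    evRow (row (+ 240 ∷ [])) U n a + + a * + 0
      ≡⟨ cong₂ _+_ (evRow-V^ 10 0 (+ 0 ∷ + 240 ∷ []) n a) (ℤₚ.*-zeroʳ (+ a)) ⟩
    + 0 + (+ 240 * V (h 0) n a + + 0) + + 0
      ≡⟨ lem (V (h 0) n a) ⟩
    + 240 * V (h 0) n a ∎
    where
    lem : ∀ x → + 0 + (+ 240 * x + + 0) + + 0 ≡ + 240 * x
    lem = solve-∀

  -- For r = 0 the value is a multiple of a (n + a)ⁿ⁻¹. For the other moments in use the polynomials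
  -- were chosen without a term of degree 0 in A, so the factor `a` makes them vanish.
  closedForm-none : ∀ r n → closedForm r (suc n) 0 ≡ + 0
  closedForm-none 0 n = trans (closedForm-0 (suc n) 0) (cong (+ 240 *_) (begin
    (+ (suc n ℕ.+ 0)) ^ suc n - + suc n * (+ (n ℕ.+ 1)) ^ n
      ≡⟨ cong₂ (λ x y → (+ x) ^ suc n - + suc n * (+ y) ^ n) (ℕₚ.+-identityʳ (suc n)) (ℕₚ.+-comm n 1) ⟩
    (+ suc n) ^ suc n - (+ suc n) ^ suc n
      ≡⟨ ℤₚ.+-inverseʳ ((+ suc n) ^ suc n) ⟩
    + 0 ∎))
  closedForm-none 1 n = refl
  closedForm-none 2 n = refl
  closedForm-none 3 n = refl
  closedForm-none 4 n = refl
  closedForm-none (suc (suc (suc (suc (suc r))))) n = refl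

  closedForm-unit : ∀ r → r ℕ.≤ 4 → + 240 * momentSum 0 r 0 1 ≡ closedForm r 0 1
  closedForm-unit 0 _ = refl
  closedForm-unit 1 _ = refl
  closedForm-unit 2 _ = refl
  closedForm-unit 3 _ = refl
  closedForm-unit 4 _ = refl
  closedForm-unit (suc (suc (suc (suc (suc r))))) (ℕ.s≤s (ℕ.s≤s (ℕ.s≤s (ℕ.s≤s ()))))

  -- An `a`-parking vector of length n ≥ 1, counted from 0, has entries at most n + a - 2, so the
  -- alphabet of size m = n + a - 1 misses none. Deleting k zeros and lowering the rest leads from
  -- (n, a + 1) to (n - k, a + k), which lowers n + a + 1 by one together with the alphabet; hence
  -- induction on m.
  momentSum≡closedForm : ∀ m r n a → r ℕ.≤ 4 → n ℕ.+ a ≡ suc m → + 240 * momentSum m r n a ≡ closedForm r n a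
  momentSum≡closedForm m       r (suc n) zero    _ _ = trans (cong (+ 240 *_) (momentSum-none m r n)) (sym (closedForm-none r n))
  momentSum≡closedForm zero    r zero    (suc zero) r≤4 _ = closedForm-unit r r≤4
  momentSum≡closedForm zero    r (suc n) (suc a) _ e with () ← trans (sym (ℕₚ.+-suc n a)) (ℕₚ.suc-injective e)
  momentSum≡closedForm (suc m) r n       (suc a) r≤4 e = begin
    + 240 * momentSum (suc m) r n (suc a)
      ≡⟨ cong (+ 240 *_) (momentSum-rec m r n a) ⟩
    + 240 * bsum r (λ s t → ff s (+ a) * L (momentSum m t) n a)
      ≡⟨ bsum-* r (+ 240) (λ s t → ff s (+ a) * L (momentSum m t) n a) ⟨
    bsum r (λ s t → + 240 * (ff s (+ a) * L (momentSum m t) n a))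
      ≡⟨ bsum-cong r (λ s t q → trans (lem (ff s (+ a)) (L (momentSum m t) n a)) (cong (ff s (+ a) *_) (inner t (t≤r s t q)))) ⟩
    bsum r (λ s t → ff s (+ a) * L (closedForm t) n a)
      ≡⟨ closedForm-rec r (recurrence-zero r r≤4) n a ⟨
    closedForm r n (suc a) ∎
    where
    lem : ∀ x y → + 240 * (x * y) ≡ x * (+ 240 * y)
    lem = solve-∀
    t≤r : ∀ s t → s ℕ.+ t ≡ r → t ℕ.≤ 4
    t≤r s t refl = ℕₚ.≤-trans (ℕₚ.m≤n+m t s) r≤4
    idx : ∀ k l → k ℕ.+ l ≡ n → l ℕ.+ (a ℕ.+ k) ≡ suc m
    idx k l refl = trans (trans (sym (ℕₚ.+-assoc l a k)) (trans (ℕₚ.+-comm (l ℕ.+ a) k) (sym (ℕₚ.+-assoc k l a))))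
      (ℕₚ.suc-injective (trans (sym (ℕₚ.+-suc (k ℕ.+ l) a)) e))
    inner : ∀ t → t ℕ.≤ 4 → + 240 * L (momentSum m t) n a ≡ L (closedForm t) n a
    inner t t≤4 = trans (sym (bsum-* n (+ 240) (λ k l → momentSum m t l (a ℕ.+ k))))
      (bsum-cong n (λ k l q → momentSum≡closedForm m t l (a ℕ.+ k) t≤4 (idx k l q)))

  -- The three-term recurrence and the reduction at a = 1

  h-0 : ∀ j a → h j 0 a ≡ + 1
  h-0 zero    a = refl
  h-0 (suc j) a = h-0 j a

  -- In generating functions this is z T′(z) = T(z) / (1 - T(z)).
  h-rel : ∀ j n a → + suc j * h (2 ℕ.+ j) n a ≡ (+ n + + a) * h j n a + (+ suc j - + a) * h (suc j) n a
  h-rel j       zero    a rewrite h-0 j a = lem (+ suc j) (+ a)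
    where
    lem : ∀ j a → j * + 1 ≡ (+ 0 + a) * + 1 + (j - a) * + 1
    lem = solve-∀
  h-rel zero    (suc n) a = begin
    + 1 * (h₀ + s * h₁′ + s * h 2 n (suc a))
      ≡⟨ lem₁ s h₀ h₁′ (h 2 n (suc a)) ⟩
    h₀ + s * h₁′ + s * (+ 1 * h 2 n (suc a))
      ≡⟨ cong (λ z → h₀ + s * h₁′ + s * z) (h-rel zero n (suc a)) ⟩
    h₀ + s * h₁′ + s * ((+ n + + suc a) * h₀′ + (+ 1 - + suc a) * h₁′)
      ≡⟨ lem₂ (+ n) (+ a) h₀ h₀′ h₁′ ⟩
    h₀ + s * h₁′ + s * ((s + + a) * h₀′) - s * (+ a * h₁′)
      ≡⟨ cong (λ z → h₀ + s * h₁′ + s * z - s * (+ a * h₁′)) pow ⟩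
    h₀ + s * h₁′ + s * h₀ - s * (+ a * h₁′)
      ≡⟨ lem₃ s (+ a) h₀ h₁′ ⟩
    (s + + a) * h₀ + (+ 1 - + a) * (h₀ + s * h₁′) ∎
    where
    s   = + suc n
    h₀  = h 0 (suc n) a
    h₀′ = h 0 n (suc a)
    h₁′ = h 1 n (suc a)
    pow : (s + + a) * h₀′ ≡ h₀
    pow = cong (λ z → (s + + a) * (+ z) ^ n) (ℕₚ.+-suc n a)
    lem₁ : ∀ s x y z → + 1 * (x + s * y + s * z) ≡ x + s * y + s * (+ 1 * z)
    lem₁ = solve-∀
    lem₂ : ∀ n a x x′ y → x + (+ 1 + n) * y + (+ 1 + n) * ((n + (+ 1 + a)) * x′ + (+ 1 - (+ 1 + a)) * y)
                        ≡ x + (+ 1 + n) * y + (+ 1 + n) * (((+ 1 + n) + a) * x′) - (+ 1 + n) * (a * y)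
    lem₂ = solve-∀
    lem₃ : ∀ s a x y → x + s * y + s * x - s * (a * y) ≡ (s + a) * x + (+ 1 - a) * (x + s * y)
    lem₃ = solve-∀
  h-rel (suc j) (suc n) a = begin
    + (2 ℕ.+ j) * (x₂ + s * y₃)
      ≡⟨ lem₁ (+ j) s x₂ y₃ ⟩
    x₂ + + suc j * x₂ + s * (+ (2 ℕ.+ j) * y₃)
      -- With j + 2 = 1 + (j + 1), one copy of `x₂` unfolds by definition and the others use the
      -- instance at `j`; `y₃` uses the instance at `n` and `suc a`.
      ≡⟨ cong₂ (λ u v → x₂ + u + s * v) (h-rel j (suc n) a) (h-rel (suc j) n (suc a)) ⟩
    x₁ + s * y₂ + ((s + + a) * x₀ + (+ suc j - + a) * x₁)
      + s * ((+ n + + suc a) * y₁ + (+ (2 ℕ.+ j) - + suc a) * y₂)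
      ≡⟨ lem₂ (+ n) (+ a) (+ j) x₀ x₁ y₁ y₂ ⟩
    (s + + a) * (x₀ + s * y₁) + (+ (2 ℕ.+ j) - + a) * (x₁ + s * y₂) ∎
    where
    s  = + suc n
    x₀ = h j (suc n) a
    x₁ = h (suc j) (suc n) a
    x₂ = h (2 ℕ.+ j) (suc n) a
    y₁ = h (suc j) n (suc a)
    y₂ = h (2 ℕ.+ j) n (suc a)
    y₃ = h (3 ℕ.+ j) n (suc a)
    lem₁ : ∀ j s x y → (+ 2 + j) * (x + s * y) ≡ x + (+ 1 + j) * x + s * ((+ 2 + j) * y)
    lem₁ = solve-∀
    lem₂ : ∀ n a j x₀ x₁ y₁ y₂ →
      x₁ + (+ 1 + n) * y₂ + (((+ 1 + n) + a) * x₀ + ((+ 1 + j) - a) * x₁)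
        + (+ 1 + n) * ((n + (+ 1 + a)) * y₁ + ((+ 2 + j) - (+ 1 + a)) * y₂)
      ≡ ((+ 1 + n) + a) * (x₀ + (+ 1 + n) * y₁) + ((+ 2 + j) - a) * (x₁ + (+ 1 + n) * y₂)
    lem₂ = solve-∀

  -- At a = 1 every power of A acts as the identity, so the rows may be added.
  collapse : Poly → Row
  collapse = foldr _⊞_ []

  ev-collapse : ∀ p f n → ev p f n 1 ≡ evRow (collapse p) f n 1
  ev-collapse []      f n = refl
  ev-collapse (r ∷ p) f n = begin
    evRow r f n 1 + + 1 * ev p f n 1              ≡⟨ cong (λ z → evRow r f n 1 + z) (trans (ℤₚ.*-identityˡ _) (ev-collapse p f n)) ⟩
    evRow r f n 1 + evRow (collapse p) f n 1      ≡⟨ evRow-⊞ r (collapse p) f n 1 ⟨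
    evRow (r ⊞ collapse p) f n 1                  ∎

  horner : Row → ℤ → ℤ
  horner []      x = + 0
  horner (c ∷ r) x = c + x * horner r x

  horner-⊞ : ∀ r s x → horner (r ⊞ s) x ≡ horner r x + horner s x
  horner-⊞ []      s       x = sym (ℤₚ.+-identityˡ _)
  horner-⊞ (c ∷ r) []      x = sym (ℤₚ.+-identityʳ _)
  horner-⊞ (c ∷ r) (d ∷ s) x rewrite horner-⊞ r s x = lem c d x (horner r x) (horner s x)
    where
    lem : ∀ c d x y z → c + d + x * (y + z) ≡ (c + x * y) + (d + x * z)
    lem = solve-∀

  horner-scale : ∀ c r x → horner (map (c *_) r) x ≡ c * horner r x
  horner-scale c []      x = sym (ℤₚ.*-zeroʳ c)
  horner-scale c (d ∷ r) x rewrite horner-scale c r x = lem c d x (horner r x)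
    where
    lem : ∀ c d x y → c * d + x * (c * y) ≡ c * (d + x * y)
    lem = solve-∀

  -- p X + q Y with p and q polynomials in n
  Form : Set
  Form = Row × Row

  ⟦_⟧ᶠ : Form → ℤ → ℤ → ℤ → ℤ
  ⟦ p , q ⟧ᶠ n X Y = horner p n * X + horner q n * Y

  infixl 6 _⊞ᶠ_
  _⊞ᶠ_ : Form → Form → Form
  (p , q) ⊞ᶠ (p′ , q′) = p ⊞ p′ , q ⊞ q′

  infixr 7 _·ᶠ_
  _·ᶠ_ : ℤ → Form → Form
  c ·ᶠ (p , q) = map (c *_) p , map (c *_) q

  mulN : Form → Form
  mulN (p , q) = p ⊞ (+ 0 ∷ p) , q ⊞ (+ 0 ∷ q)

  module _ (n X Y : ℤ) where
    ⊞ᶠ-sound : ∀ φ ψ → ⟦ φ ⊞ᶠ ψ ⟧ᶠ n X Y ≡ ⟦ φ ⟧ᶠ n X Y + ⟦ ψ ⟧ᶠ n X Y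
    ⊞ᶠ-sound (p , q) (p′ , q′) rewrite horner-⊞ p p′ n | horner-⊞ q q′ n =
      lem (horner p n) (horner p′ n) (horner q n) (horner q′ n) X Y
      where
      lem : ∀ a b c d x y → (a + b) * x + (c + d) * y ≡ (a * x + c * y) + (b * x + d * y)
      lem = solve-∀

    ·ᶠ-sound : ∀ c φ → ⟦ c ·ᶠ φ ⟧ᶠ n X Y ≡ c * ⟦ φ ⟧ᶠ n X Y
    ·ᶠ-sound c (p , q) rewrite horner-scale c p n | horner-scale c q n = lem c (horner p n) (horner q n) X Y
      where
      lem : ∀ c a b x y → c * a * x + c * b * y ≡ c * (a * x + b * y)
      lem = solve-∀

    mulN-sound : ∀ φ → ⟦ mulN φ ⟧ᶠ n X Y ≡ (n + + 1) * ⟦ φ ⟧ᶠ n X Y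
    mulN-sound (p , q) rewrite horner-⊞ p (+ 0 ∷ p) n | horner-⊞ q (+ 0 ∷ q) n =
      lem (horner p n) (horner q n) n X Y
      where
      lem : ∀ a b n x y → (a + (+ 0 + n * a)) * x + (b + (+ 0 + n * b)) * y ≡ (n + + 1) * (a * x + b * y)
      lem = solve-∀

  -- The Abel polynomial a (n + a)ⁿ⁻¹ for n ≥ 1, which is the number of `a`-parking vectors of
  -- length n.
  h₋₁ : Fun
  h₋₁ = V (h 0)

  h₋₁-1 : ∀ n → h₋₁ (suc n) 1 ≡ (+ suc (suc n)) ^ n
  h₋₁-1 n = begin
    (+ (suc n ℕ.+ 1)) ^ suc n - + suc n * (+ (n ℕ.+ 2)) ^ n
      ≡⟨ cong₂ (λ x y → (+ x) ^ suc n - + suc n * (+ y) ^ n) (ℕₚ.+-comm (suc n) 1) (ℕₚ.+-comm n 2) ⟩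
    (+ 1 + + suc n) * p - + suc n * p
      ≡⟨ lem (+ suc n) p ⟩
    p ∎
    where
    p = (+ suc (suc n)) ^ n
    lem : ∀ s p → (+ 1 + s) * p - s * p ≡ p
    lem = solve-∀

  h-0-1 : ∀ n → h 0 n 1 ≡ (+ n + + 1) * h₋₁ n 1
  h-0-1 zero    = refl
  h-0-1 (suc n) = trans (cong (λ z → (+ z) ^ suc n) (ℕₚ.+-comm (suc n) 1))
    (cong₂ _*_ (ℤₚ.+-comm (+ 1) (+ suc n)) (sym (h₋₁-1 n)))

  one : Form
  one = + 1 ∷ [] , []

  -- i! times h (i + 1) at a = 1, with X = h₋₁ n 1 and Y = h 1 n 1
  poleForm : ℕ → Form
  poleForm zero          = [] , + 1 ∷ []
  poleForm (suc zero)    = mulN (mulN one)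
  poleForm (suc (suc i)) = + suc i ·ᶠ (mulN (poleForm i) ⊞ᶠ poleForm (suc i))

  -- i! times a combination of h (i + 1), …, h 1, h 0, h (-1)
  rowForm : ℕ → Row → Form
  rowForm zero    (c ∷ d ∷ e ∷ []) = c ·ᶠ poleForm 0 ⊞ᶠ d ·ᶠ mulN one ⊞ᶠ e ·ᶠ one
  rowForm (suc i) (c ∷ r)          = c ·ᶠ poleForm (suc i) ⊞ᶠ + suc i ·ᶠ rowForm i r
  rowForm _       _                = [] , []

  module _ (n : ℕ) where
    private
      ⟪_⟫ : Form → ℤ
      ⟪ φ ⟫ = ⟦ φ ⟧ᶠ (+ n) (h₋₁ n 1) (h 1 n 1)

    poleForm-sound : ∀ i → + (i !) * h (suc i) n 1 ≡ ⟪ poleForm i ⟫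
    poleForm-sound zero = lem (+ n) (h₋₁ n 1) (h 1 n 1)
      where
      lem : ∀ n x y → + 1 * y ≡ + 0 * x + (+ 1 + n * + 0) * y
      lem = solve-∀
    poleForm-sound (suc zero) = begin
      + 1 * h 2 n 1
        -- The coefficient j + 1 - a of `h 1` vanishes at j = 0, a = 1, so `h 2` is a multiple of
        -- `h₋₁` alone.
        ≡⟨ h-rel 0 n 1 ⟩
      (+ n + + 1) * h 0 n 1 + + 0 * h 1 n 1
        ≡⟨ cong (λ z → (+ n + + 1) * z + + 0 * h 1 n 1) (h-0-1 n) ⟩
      (+ n + + 1) * ((+ n + + 1) * h₋₁ n 1) + + 0 * h 1 n 1
        ≡⟨ lem (+ n + + 1) (+ n) (h₋₁ n 1) (h 1 n 1) ⟩
      (+ n + + 1) * ((+ n + + 1) * ⟪ one ⟫)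
        ≡⟨ cong ((+ n + + 1) *_) (mulN-sound (+ n) (h₋₁ n 1) (h 1 n 1) one) ⟨
      (+ n + + 1) * ⟪ mulN one ⟫
        ≡⟨ mulN-sound (+ n) (h₋₁ n 1) (h 1 n 1) (mulN one) ⟨
      ⟪ mulN (mulN one) ⟫ ∎
      where
      lem : ∀ m n x y → m * (m * x) + + 0 * y ≡ m * (m * ((+ 1 + n * + 0) * x + + 0 * y))
      lem = solve-∀
    poleForm-sound (suc (suc i)) = begin
      + (suc (suc i) !) * h (3 ℕ.+ i) n 1
        ≡⟨ cong (_* h (3 ℕ.+ i) n 1) (trans (ℤₚ.pos-* (suc (suc i)) (suc i !)) (cong (+ suc (suc i) *_) (ℤₚ.pos-* (suc i) (i !)))) ⟩
      + suc (suc i) * (+ suc i * + (i !)) * h (3 ℕ.+ i) n 1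
        ≡⟨ lem₁ (+ suc (suc i)) (+ suc i) (+ (i !)) (h (3 ℕ.+ i) n 1) ⟩
      + suc i * + (i !) * (+ suc (suc i) * h (3 ℕ.+ i) n 1)
        -- The factor i + 2 of the factorial is the one on the left of `h-rel`; the scaling by
        -- factorials serves to avoid this division.
        ≡⟨ cong (+ suc i * + (i !) *_) (h-rel (suc i) n 1) ⟩
      + suc i * + (i !) * ((+ n + + 1) * h (suc i) n 1 + + suc i * h (2 ℕ.+ i) n 1)
        ≡⟨ lem₂ (+ suc i) (+ (i !)) (+ n + + 1) (h (suc i) n 1) (h (2 ℕ.+ i) n 1) ⟩
      + suc i * ((+ n + + 1) * (+ (i !) * h (suc i) n 1) + + suc i * + (i !) * h (2 ℕ.+ i) n 1)
        ≡⟨ cong (λ z → + suc i * ((+ n + + 1) * (+ (i !) * h (suc i) n 1) + z * h (2 ℕ.+ i) n 1)) (ℤₚ.pos-* (suc i) (i !)) ⟨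
      + suc i * ((+ n + + 1) * (+ (i !) * h (suc i) n 1) + + (suc i !) * h (2 ℕ.+ i) n 1)
        ≡⟨ cong₂ (λ y z → + suc i * ((+ n + + 1) * y + z)) (poleForm-sound i) (poleForm-sound (suc i)) ⟩
      + suc i * ((+ n + + 1) * ⟪ poleForm i ⟫ + ⟪ poleForm (suc i) ⟫)
        ≡⟨ cong (λ z → + suc i * (z + ⟪ poleForm (suc i) ⟫)) (mulN-sound (+ n) (h₋₁ n 1) (h 1 n 1) (poleForm i)) ⟨
      + suc i * (⟪ mulN (poleForm i) ⟫ + ⟪ poleForm (suc i) ⟫)
        ≡⟨ cong (+ suc i *_) (⊞ᶠ-sound (+ n) (h₋₁ n 1) (h 1 n 1) (mulN (poleForm i)) (poleForm (suc i))) ⟨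
      + suc i * ⟪ mulN (poleForm i) ⊞ᶠ poleForm (suc i) ⟫
        ≡⟨ ·ᶠ-sound (+ n) (h₋₁ n 1) (h 1 n 1) (+ suc i) (mulN (poleForm i) ⊞ᶠ poleForm (suc i)) ⟨
      ⟪ poleForm (suc (suc i)) ⟫ ∎
      where
      lem₁ : ∀ a b c x → a * (b * c) * x ≡ b * c * (a * x)
      lem₁ = solve-∀
      lem₂ : ∀ s f m x y → s * f * (m * x + s * y) ≡ s * (m * (f * x) + s * f * y)
      lem₂ = solve-∀

    rowForm-sound : ∀ i r → length r ≡ 3 ℕ.+ i → + (i !) * evRow r (h (suc i)) n 1 ≡ ⟪ rowForm i r ⟫
    rowForm-sound zero (c ∷ d ∷ e ∷ []) _ = begin
      + 1 * (c * h 1 n 1 + (d * V (h 1) n 1 + (e * V (V (h 1)) n 1 + + 0)))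
        ≡⟨ cong₂ (λ x y → + 1 * (c * h 1 n 1 + (d * x + (e * y + + 0))))
             (trans (V-h 0 n 1) (h-0-1 n)) (V-cong (V-h 0) n 1) ⟩
      + 1 * (c * h 1 n 1 + (d * ((+ n + + 1) * h₋₁ n 1) + (e * h₋₁ n 1 + + 0)))
        ≡⟨ lem c d e (+ n) (h₋₁ n 1) (h 1 n 1) ⟩
      c * ⟪ [] , + 1 ∷ [] ⟫ + d * ((+ n + + 1) * ⟪ one ⟫) + e * ⟪ one ⟫
        ≡⟨ cong₂ _+_ (cong₂ _+_ (sym (·ᶠ-sound (+ n) (h₋₁ n 1) (h 1 n 1) c ([] , + 1 ∷ [])))
                                (sym (trans (·ᶠ-sound (+ n) (h₋₁ n 1) (h 1 n 1) d (mulN one)) (cong (d *_) (mulN-sound (+ n) (h₋₁ n 1) (h 1 n 1) one)))))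
                     (sym (·ᶠ-sound (+ n) (h₋₁ n 1) (h 1 n 1) e one)) ⟩
      ⟪ φ ⟫ + ⟪ χ ⟫ + ⟪ ψ ⟫
        ≡⟨ cong (λ z → z + ⟪ ψ ⟫) (⊞ᶠ-sound (+ n) (h₋₁ n 1) (h 1 n 1) φ χ) ⟨
      ⟪ φ ⊞ᶠ χ ⟫ + ⟪ ψ ⟫
        ≡⟨ ⊞ᶠ-sound (+ n) (h₋₁ n 1) (h 1 n 1) (φ ⊞ᶠ χ) ψ ⟨
      ⟪ φ ⊞ᶠ χ ⊞ᶠ ψ ⟫ ∎
      where
      φ = c ·ᶠ poleForm 0
      χ = d ·ᶠ mulN one
      ψ = e ·ᶠ one
      lem : ∀ c d e n x y → + 1 * (c * y + (d * ((n + + 1) * x) + (e * x + + 0)))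
            ≡ c * (+ 0 * x + (+ 1 + n * + 0) * y) + d * ((n + + 1) * ((+ 1 + n * + 0) * x + + 0 * y))
              + e * ((+ 1 + n * + 0) * x + + 0 * y)
      lem = solve-∀
    rowForm-sound (suc i) (c ∷ r) e = begin
      + (suc i !) * (c * h (2 ℕ.+ i) n 1 + evRow r (V (h (2 ℕ.+ i))) n 1)
        ≡⟨ cong (λ z → + (suc i !) * (c * h (2 ℕ.+ i) n 1 + z)) (evRow-cong r (V-h (suc i)) n 1) ⟩
      + (suc i !) * (c * h (2 ℕ.+ i) n 1 + R)
        ≡⟨ lem₁ (+ (suc i !)) c (h (2 ℕ.+ i) n 1) R ⟩
      c * (+ (suc i !) * h (2 ℕ.+ i) n 1) + + (suc i !) * R
        ≡⟨ cong₂ (λ y z → c * y + z * R) (poleForm-sound (suc i)) (ℤₚ.pos-* (suc i) (i !)) ⟩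
      c * ⟪ poleForm (suc i) ⟫ + + suc i * + (i !) * R
        ≡⟨ cong (λ z → c * ⟪ poleForm (suc i) ⟫ + z)
             (trans (ℤₚ.*-assoc (+ suc i) (+ (i !)) R) (cong (+ suc i *_) (rowForm-sound i r (ℕₚ.suc-injective e)))) ⟩
      c * ⟪ poleForm (suc i) ⟫ + + suc i * ⟪ rowForm i r ⟫
        ≡⟨ cong₂ _+_ (·ᶠ-sound (+ n) (h₋₁ n 1) (h 1 n 1) c (poleForm (suc i))) (·ᶠ-sound (+ n) (h₋₁ n 1) (h 1 n 1) (+ suc i) (rowForm i r)) ⟨
      ⟪ c ·ᶠ poleForm (suc i) ⟫ + ⟪ + suc i ·ᶠ rowForm i r ⟫
        ≡⟨ ⊞ᶠ-sound (+ n) (h₋₁ n 1) (h 1 n 1) (c ·ᶠ poleForm (suc i)) (+ suc i ·ᶠ rowForm i r) ⟨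
      ⟪ rowForm (suc i) (c ∷ r) ⟫ ∎
      where
      R = evRow r (h (suc i)) n 1
      lem₁ : ∀ f c x y → f * (c * x + y) ≡ c * (f * x) + f * y
      lem₁ = solve-∀

    closedForm-4-form : + 362880 * closedForm 4 n 1 ≡ ⟪ rowForm 9 (collapse (momentPoly 4)) ⟫
    closedForm-4-form = trans (cong (+ 362880 *_) (ev-collapse (momentPoly 4) U n)) (rowForm-sound 9 (collapse (momentPoly 4)) refl)

  -- The coefficients of the fourth moment sum, times 87091200 = 9! · 240.
  p₄ q₄ : Row
  p₄ = + 1450952640 ∷ + 5434672320 ∷ + 7762320000 ∷ + 5609255040 ∷ + 2130477120 ∷ + 374074560 ∷ + 19094400 ∷ []
  q₄ = - + 1450952640 ∷ - + 3072660480 ∷ - + 2250599040 ∷ - + 724147200 ∷ - + 95256000 ∷ []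

  horner-isZero : ∀ r → isZeroRow r ≡ true → ∀ x → horner r x ≡ + 0
  horner-isZero []        _ x = refl
  horner-isZero (+ 0 ∷ r) e x = trans (ℤₚ.+-identityˡ _) (trans (cong (x *_) (horner-isZero r e x)) (ℤₚ.*-zeroʳ x))

  -- `mulN` can append zero coefficients, so lists for the same polynomial may differ in length; the
  -- test is therefore on their difference.
  horner-≡ : ∀ r s → isZeroRow (r ⊞ map ((- + 1) *_) s) ≡ true → ∀ x → horner r x ≡ horner s x
  horner-≡ r s e x = ℤₚ.i-j≡0⇒i≡j (horner r x) (horner s x) (begin
    horner r x - horner s x
      ≡⟨ cong (λ z → horner r x + z) (trans (horner-scale (- + 1) s x) (ℤₚ.-1*i≡-i _)) ⟨
    horner r x + horner (map ((- + 1) *_) s) x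
      ≡⟨ horner-⊞ r (map ((- + 1) *_) s) x ⟨
    horner (r ⊞ map ((- + 1) *_) s) x
      ≡⟨ horner-isZero (r ⊞ map ((- + 1) *_) s) e x ⟩
    + 0 ∎)

  closedForm-4 : ∀ n → + 362880 * closedForm 4 n 1 ≡ horner p₄ (+ n) * h₋₁ n 1 + horner q₄ (+ n) * h 1 n 1
  closedForm-4 n = trans (closedForm-4-form n) (cong₂ (λ x y → x * h₋₁ n 1 + y * h 1 n 1)
    (horner-≡ (proj₁ form) p₄ refl (+ n)) (horner-≡ (proj₂ form) q₄ refl (+ n)))
    where form = rowForm 9 (collapse (momentPoly 4))

  momentSum-4 : ∀ n → + 87091200 * momentSum n 4 n 1 ≡ horner p₄ (+ n) * h₋₁ n 1 + horner q₄ (+ n) * h 1 n 1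
  momentSum-4 n = trans (ℤₚ.*-assoc (+ 362880) (+ 240) (momentSum n 4 n 1))
    (trans (cong (+ 362880 *_) (momentSum≡closedForm n 4 n 1 ℕₚ.≤-refl (ℕₚ.+-comm n 1))) (closedForm-4 n))

  momentSum-0 : ∀ n → momentSum n 0 n 1 ≡ h₋₁ n 1
  momentSum-0 n = ℤₚ.*-cancelˡ-≡ (+ 240) (momentSum n 0 n 1) (h₋₁ n 1)
    (trans (momentSum≡closedForm n 0 n 1 ℕ.z≤n (ℕₚ.+-comm n 1)) (closedForm-0 n 1))

-- Positivity and growth bounds

module Estimates where
  open MomentSums
  open import Data.Integer using (ℤ; +_; -[1+_]; +≤+; ∣_∣; _+_; _*_; _-_; _≤_; _^_)
  open import Data.Integer.Tactic.RingSolver using (solve-∀)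

  +-nonneg : ∀ {i j} → + 0 ≤ i → + 0 ≤ j → + 0 ≤ i + j
  +-nonneg = ℤₚ.+-mono-≤

  *-nonneg : ∀ {i j} → + 0 ≤ i → + 0 ≤ j → + 0 ≤ i * j
  *-nonneg {+ i} {+ j} _ _ = subst (+ 0 ≤_) (ℤₚ.pos-* i j) (+≤+ z≤n)

  pos-nonneg : ∀ {n} → + 0 ≤ + n
  pos-nonneg = +≤+ z≤n

  ^-nonneg : ∀ m k → + 0 ≤ (+ m) ^ k
  ^-nonneg m zero    = pos-nonneg
  ^-nonneg m (suc k) = *-nonneg (pos-nonneg {m}) (^-nonneg m k)

  h-nonneg : ∀ j n a → + 0 ≤ h j n a
  h-nonneg zero    n       a = ^-nonneg (n ℕ.+ a) n
  h-nonneg (suc j) zero    a = h-nonneg j zero a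
  h-nonneg (suc j) (suc n) a = +-nonneg (h-nonneg j (suc n) a) (*-nonneg (pos-nonneg {suc n}) (h-nonneg (suc j) n (suc a)))

  h-mono : ∀ j n a → + 0 ≤ h (suc j) n a - h j n a
  h-mono j zero    a rewrite h-0 j a = pos-nonneg
  h-mono j (suc n) a = subst (+ 0 ≤_) (sym (lem (h j (suc n) a) (+ suc n * h (suc j) n (suc a))))
    (*-nonneg (pos-nonneg {suc n}) (h-nonneg (suc j) n (suc a)))
    where
    lem : ∀ x y → x + y - x ≡ y
    lem = solve-∀

  -- Here h 1 = Σ tᵢ and h 2 = Σ (i + 1) tᵢ with 0 ≤ tᵢ ≤ h 0, and (Σ tᵢ)² ≤ Σ (2i + 1) tᵢ h 0.
  h-quadratic : ∀ n a → + 0 ≤ + 2 * h 0 n a * h 2 n a - h 1 n a * h 1 n a - h 0 n a * h 1 n a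
  h-quadratic zero    a = pos-nonneg
  h-quadratic (suc n) a = subst (+ 0 ≤_) (lem s (+ a) p y z)
    -- Once the squares of `h 0` cancel, the excess over s² times the induction hypothesis is a p s
    -- (2z - y), and y ≤ z by `h-mono`.
    (+-nonneg (*-nonneg (*-nonneg (pos-nonneg {suc n}) (pos-nonneg {suc n})) ih)
              (*-nonneg (*-nonneg (pos-nonneg {a}) (^-nonneg (suc n ℕ.+ a) n)) (*-nonneg (pos-nonneg {suc n})
                (+-nonneg (h-mono 1 n (suc a)) (h-nonneg 2 n (suc a))))))
    where
    s = + suc n
    p = (+ (suc n ℕ.+ a)) ^ n
    y = h 1 n (suc a)
    z = h 2 n (suc a)
    ih : + 0 ≤ + 2 * p * z - y * y - p * y
    ih = subst (λ m → + 0 ≤ + 2 * (+ m) ^ n * z - y * y - (+ m) ^ n * y) (ℕₚ.+-suc n a) (h-quadratic n (suc a))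
    lem : ∀ s a p y z →
      s * s * (+ 2 * p * z - y * y - p * y) + a * p * (s * ((z - y) + z))
      ≡ + 2 * ((s + a) * p) * ((s + a) * p + s * y + s * z)
        - ((s + a) * p + s * y) * ((s + a) * p + s * y) - ((s + a) * p) * ((s + a) * p + s * y)
    lem = solve-∀

  absSum : Row → ℕ
  absSum []      = 0
  absSum (c ∷ r) = ∣ c ∣ ℕ.+ absSum r

  -- The argument is at least 1, so each power occurring is at most the `d`-th.
  horner-bound : ∀ r d n → length r ℕ.≤ suc d → ∣ horner r (+ suc n) ∣ ℕ.≤ absSum r ℕ.* suc n ℕ.^ d
  horner-bound []      d       n _ = z≤n
  horner-bound (c ∷ []) zero   n _ = ℕₚ.≤-trans
    (ℤₚ.∣i+j∣≤∣i∣+∣j∣ c (+ suc n * + 0))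
    (ℕₚ.≤-reflexive (trans (cong (∣ c ∣ ℕ.+_) (cong ∣_∣ (ℤₚ.*-zeroʳ (+ suc n)))) (lem ∣ c ∣)))
    where
    lem : ∀ x → x ℕ.+ 0 ≡ (x ℕ.+ 0) ℕ.* 1
    lem x = sym (ℕₚ.*-identityʳ _)
  horner-bound (c ∷ r) (suc d) n (s≤s l) = begin
    ∣ c + + suc n * horner r (+ suc n) ∣
      ≤⟨ ℤₚ.∣i+j∣≤∣i∣+∣j∣ c (+ suc n * horner r (+ suc n)) ⟩
    ∣ c ∣ ℕ.+ ∣ + suc n * horner r (+ suc n) ∣
      ≡⟨ cong (∣ c ∣ ℕ.+_) (ℤₚ.abs-* (+ suc n) (horner r (+ suc n))) ⟩
    ∣ c ∣ ℕ.+ suc n ℕ.* ∣ horner r (+ suc n) ∣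
      ≤⟨ ℕₚ.+-mono-≤ (ℕₚ.m≤m*n ∣ c ∣ (suc n ℕ.^ suc d) {{ℕₚ.m^n≢0 (suc n) (suc d)}})
                     (ℕₚ.*-monoʳ-≤ (suc n) (horner-bound r d n l)) ⟩
    ∣ c ∣ ℕ.* suc n ℕ.^ suc d ℕ.+ suc n ℕ.* (absSum r ℕ.* suc n ℕ.^ d)
      ≡⟨ cong (∣ c ∣ ℕ.* suc n ℕ.^ suc d ℕ.+_) (trans (sym (ℕₚ.*-assoc (suc n) (absSum r) _))
           (trans (cong (ℕ._* suc n ℕ.^ d) (ℕₚ.*-comm (suc n) (absSum r))) (ℕₚ.*-assoc (absSum r) (suc n) _))) ⟩
    ∣ c ∣ ℕ.* suc n ℕ.^ suc d ℕ.+ absSum r ℕ.* suc n ℕ.^ suc d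
      ≡⟨ ℕₚ.*-distribʳ-+ (suc n ℕ.^ suc d) ∣ c ∣ (absSum r) ⟨
    (∣ c ∣ ℕ.+ absSum r) ℕ.* suc n ℕ.^ suc d ∎
    where open ℕₚ.≤-Reasoning

  square-bound : ∀ i m → ∣ i ∣ ℕ.≤ m → + 0 ≤ + m * + m - i * i
  square-bound i m le = ℤₚ.i≤j⇒0≤j-i (subst₂ _≤_ (trans (ℤₚ.pos-* ∣ i ∣ ∣ i ∣) (abs² i)) (ℤₚ.pos-* m m) (+≤+ (ℕₚ.*-mono-≤ le le)))
    where
    abs² : ∀ i → + ∣ i ∣ * + ∣ i ∣ ≡ i * i
    abs² (+ n)    = refl
    abs² -[1+ n ] = refl

-- Passage to the rational numbers

module Expectation where
  open MomentSums
  open Estimates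
  open import Data.Integer as ℤ using (ℤ; +_; +≤+)
  open import Data.Rational
    using (ℚ; _/_; _+_; _*_; _-_; -_; 0ℚ; 1ℚ; toℚᵘ; nonNegative; Positive) renaming (_≤_ to _≤ℚ_)
  open ≡-Reasoning

  ℚ-ring : ACR.AlmostCommutativeRing 0ℓ 0ℓ
  ℚ-ring = ACR.fromCommutativeRing ℚₚ.+-*-commutativeRing (λ x → dec⇒maybe (0ℚ ℚₚ.≟ x))

  ι : ℤ → ℚ
  ι i = i / 1

  toℚᵘ-/ : ∀ i d → toℚᵘ (i / suc d) ≃ mkℚᵘ i d
  toℚᵘ-/ i d = ℚₚ.toℚᵘ-fromℚᵘ (mkℚᵘ i d)

  ι-+ : ∀ i j → ι (i ℤ.+ j) ≡ ι i + ι j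
  ι-+ i j = ℚₚ.toℚᵘ-injective (ℚᵘₚ.≃-trans (toℚᵘ-/ (i ℤ.+ j) 0) (ℚᵘₚ.≃-sym
    (ℚᵘₚ.≃-trans (ℚₚ.toℚᵘ-homo-+ (ι i) (ι j)) (ℚᵘₚ.≃-trans (ℚᵘₚ.+-cong (toℚᵘ-/ i 0) (toℚᵘ-/ j 0)) (*≡* (lem i j))))))
    where
    lem : ∀ i j → (i ℤ.* + 1 ℤ.+ j ℤ.* + 1) ℤ.* + 1 ≡ (i ℤ.+ j) ℤ.* + 1
    lem = ℤSolver.solve-∀

  ι-* : ∀ i j → ι (i ℤ.* j) ≡ ι i * ι j
  ι-* i j = ℚₚ.toℚᵘ-injective (ℚᵘₚ.≃-trans (toℚᵘ-/ (i ℤ.* j) 0) (ℚᵘₚ.≃-sym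
    (ℚᵘₚ.≃-trans (ℚₚ.toℚᵘ-homo-* (ι i) (ι j)) (ℚᵘₚ.≃-trans (ℚᵘₚ.*-cong (toℚᵘ-/ i 0) (toℚᵘ-/ j 0)) (*≡* refl)))))

  ι-neg : ∀ i → ι (ℤ.- i) ≡ - ι i
  ι-neg i = ℚₚ.toℚᵘ-injective (ℚᵘₚ.≃-trans (toℚᵘ-/ (ℤ.- i) 0) (ℚᵘₚ.≃-sym
    (ℚᵘₚ.≃-trans (ℚₚ.toℚᵘ-homo‿- (ι i)) (ℚᵘₚ.-‿cong (toℚᵘ-/ i 0)))))

  ι-- : ∀ i j → ι (i ℤ.- j) ≡ ι i - ι j
  ι-- i j = trans (ι-+ i (ℤ.- j)) (cong (λ z → ι i + z) (ι-neg j))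

  /-* : ∀ i d .{{_ : ℕ.NonZero d}} → (i / d) * ⟦ d ⟧ ≡ ι i
  /-* i (suc d) = ℚₚ.toℚᵘ-injective (ℚᵘₚ.≃-trans (ℚₚ.toℚᵘ-homo-* (i / suc d) ⟦ suc d ⟧)
    (ℚᵘₚ.≃-trans (ℚᵘₚ.*-cong (toℚᵘ-/ i d) (toℚᵘ-/ (+ suc d) 0))
      (ℚᵘₚ.≃-trans (*≡* (lem i (+ suc d))) (ℚᵘₚ.≃-sym (toℚᵘ-/ i 0)))))
    where
    lem : ∀ i s → i ℤ.* s ℤ.* + 1 ≡ i ℤ.* (s ℤ.* + 1)
    lem = ℤSolver.solve-∀

  -- From lists of parking functions to moment sums

  listSum : {X : Set} → (X → ℤ) → List X → ℤ
  listSum g []       = + 0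
  listSum g (x ∷ xs) = g x ℤ.+ listSum g xs

  listSum-++ : ∀ {X : Set} (g : X → ℤ) xs ys → listSum g (xs ++ ys) ≡ listSum g xs ℤ.+ listSum g ys
  listSum-++ g []       ys = sym (ℤₚ.+-identityˡ _)
  listSum-++ g (x ∷ xs) ys = trans (cong (λ z → g x ℤ.+ z) (listSum-++ g xs ys)) (sym (ℤₚ.+-assoc (g x) _ _))

  listSum-concatMap : ∀ {X Y : Set} (g : Y → ℤ) (k : X → List Y) xs →
                      listSum g (concatMap k xs) ≡ listSum (λ x → listSum g (k x)) xs
  listSum-concatMap g k []       = refl
  listSum-concatMap g k (x ∷ xs) = trans (listSum-++ g (k x) (concatMap k xs))
    (cong (λ z → listSum g (k x) ℤ.+ z) (listSum-concatMap g k xs))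

  listSum-cong : ∀ {X : Set} {f g : X → ℤ} → (∀ x → f x ≡ g x) → ∀ xs → listSum f xs ≡ listSum g xs
  listSum-cong e []       = refl
  listSum-cong e (x ∷ xs) = cong₂ ℤ._+_ (e x) (listSum-cong e xs)

  listSum-extend : ∀ (g : List ℕ → ℤ) v m (f : ℕ → ℕ) →
    listSum g (map (λ x → x ∷ v) (map suc (applyUpTo f m))) ≡ rangeSum m (λ i → g (suc (f i) ∷ v))
  listSum-extend g v zero    f = refl
  listSum-extend g v (suc m) f = cong (λ z → g (suc (f 0) ∷ v) ℤ.+ z) (listSum-extend g v m (λ i → f (suc i)))

  listSum-vectors : ∀ m n g → listSum g (vectors m n) ≡ vecSum m n (λ v → g (map suc v))
  listSum-vectors m zero    g = ℤₚ.+-identityʳ (g [])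
  listSum-vectors m (suc n) g = begin
    listSum g (concatMap (λ v → map (λ x → x ∷ v) (map suc (upTo m))) (vectors m n))
      ≡⟨ listSum-concatMap g (λ v → map (λ x → x ∷ v) (map suc (upTo m))) (vectors m n) ⟩
    listSum (λ v → listSum g (map (λ x → x ∷ v) (map suc (upTo m)))) (vectors m n)
      ≡⟨ listSum-cong (λ v → listSum-extend g v m (λ i → i)) (vectors m n) ⟩
    listSum (λ v → rangeSum m (λ i → g (suc i ∷ v))) (vectors m n)
      ≡⟨ listSum-vectors m n (λ v → rangeSum m (λ i → g (suc i ∷ v))) ⟩
    vecSum m (suc n) (λ v → g (map suc v)) ∎

  filter-sum : ∀ {X : Set} (P : X → Bool) (f : X → ℚ) (g : X → ℤ) → (∀ x → f x ≡ ι (g x)) → ∀ xs →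
               sumℚ (map f (filterᵇ P xs)) ≡ ι (listSum (λ x → if P x then g x else + 0) xs)
  filter-sum P f g e []       = refl
  filter-sum P f g e (x ∷ xs) with P x
  ... | true  = trans (cong₂ _+_ (e x) (filter-sum P f g e xs)) (sym (ι-+ (g x) _))
  ... | false = trans (filter-sum P f g e xs) (cong ι (sym (ℤₚ.+-identityˡ (listSum (λ x → if P x then g x else + 0) xs))))

  filter-length : ∀ {X : Set} (P : X → Bool) xs →
                  + length (filterᵇ P xs) ≡ listSum (λ x → if P x then + 1 else + 0) xs
  filter-length P []       = refl
  filter-length P (x ∷ xs) with P x
  ... | true  = cong (λ z → + 1 ℤ.+ z) (filter-length P xs)
  ... | false = trans (filter-length P xs) (sym (ℤₚ.+-identityˡ _))

  -- The default `mean [] = 0` makes the empty case true, so that positivity of the count enters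
  -- only when `h₋₁` is cancelled.
  mean-length : ∀ xs → mean xs * ⟦ length xs ⟧ ≡ sumℚ xs
  mean-length []       = refl
  mean-length (x ∷ xs) = begin
    s * u * ⟦ suc (length xs) ⟧      ≡⟨ ℚₚ.*-assoc s u ⟦ suc (length xs) ⟧ ⟩
    s * (u * ⟦ suc (length xs) ⟧)    ≡⟨ cong (s *_) (/-* (+ 1) (suc (length xs))) ⟩
    s * 1ℚ                           ≡⟨ ℚₚ.*-identityʳ s ⟩
    s                                ∎
    where
    s = sumℚ (x ∷ xs)
    u = + 1 / suc (length xs)

  sortedCheck-suc : ∀ i w → sortedCheck i (map suc w) ≡ fits i w
  sortedCheck-suc i []      = refl
  sortedCheck-suc i (x ∷ w) = cong ((suc x ≤ᵇ i) ∧_) (sortedCheck-suc (suc i) w)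


  vecSum-length : ∀ m n {f g} → (∀ v → length v ≡ n → f v ≡ g v) → vecSum m n f ≡ vecSum m n g
  vecSum-length m zero    e = e [] refl
  vecSum-length m (suc n) e = vecSum-length m n λ v q →
    Linear.ext (rangeSum-linear m) λ i → e (i ∷ v) (cong suc q)

  sumℕ-suc : ∀ v → sumℕ (map suc v) ≡ length v ℕ.+ sumℕ v
  sumℕ-suc []      = refl
  sumℕ-suc (x ∷ v) = cong suc (trans (cong (x ℕ.+_) (sumℕ-suc v))
    (trans (sym (ℕₚ.+-assoc x (length v) _)) (trans (cong (ℕ._+ sumℕ v) (ℕₚ.+-comm x (length v))) (ℕₚ.+-assoc (length v) x _))))

  pfArea : ℕ → List ℕ → ℤ
  pfArea n p = + tri (suc n) ℤ.- + sumℕ p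

  pfArea-suc : ∀ n v → length v ≡ n → pfArea n (map suc v) ≡ areaℤ 1 v
  pfArea-suc n v refl = begin
    + tri (suc (length v)) ℤ.- + sumℕ (map suc v)
      ≡⟨ cong₂ (λ x y → + tri x ℤ.- + y) (ℕₚ.+-comm 1 (length v)) (sumℕ-suc v) ⟩
    + tri (length v ℕ.+ 1) ℤ.- (+ length v ℤ.+ + sumℕ v)
      ≡⟨ lem (+ tri (length v ℕ.+ 1)) (+ length v) (+ sumℕ v) ⟩
    areaℤ 1 v ∎
    where
    lem : ∀ t l s → t ℤ.- (l ℤ.+ s) ≡ t ℤ.- l ℤ.- s
    lem = ℤSolver.solve-∀

  pf-sum : ∀ r n → listSum (λ p → if isParkingFunction p then ff r (pfArea n p) else + 0) (vectors n n) ≡ momentSum n r n 1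
  pf-sum r n = trans (listSum-vectors n n (λ p → if isParkingFunction p then ff r (pfArea n p) else + 0))
    (vecSum-length n n λ v q → cong₂ (λ b z → if b then ff r z else + 0)
      (trans (cong (sortedCheck 1) (sort-suc v)) (sortedCheck-suc 1 (sort v))) (pfArea-suc n v q))

  tri-double : ∀ n → tri (suc n) ℕ.* 2 ≡ n ℕ.* suc n
  tri-double zero    = refl
  tri-double (suc n) = begin
    (suc n ℕ.+ tri (suc n)) ℕ.* 2         ≡⟨ ℕₚ.*-distribʳ-+ 2 (suc n) (tri (suc n)) ⟩
    suc n ℕ.* 2 ℕ.+ tri (suc n) ℕ.* 2     ≡⟨ cong (suc n ℕ.* 2 ℕ.+_) (trans (tri-double n) (ℕₚ.*-comm n (suc n))) ⟩
    suc n ℕ.* 2 ℕ.+ suc n ℕ.* n           ≡⟨ ℕₚ.*-distribˡ-+ (suc n) 2 n ⟨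
    suc n ℕ.* (2 ℕ.+ n)                   ∎

  halve : ∀ i → (i ℤ.* + 2) / 2 ≡ ι i
  halve i = ℚₚ.toℚᵘ-injective (ℚᵘₚ.≃-trans (toℚᵘ-/ (i ℤ.* + 2) 1)
    (ℚᵘₚ.≃-trans (*≡* (ℤₚ.*-identityʳ (i ℤ.* + 2))) (ℚᵘₚ.≃-sym (toℚᵘ-/ i 0))))

  area≡pfArea : ∀ n p → area n p ≡ ι (pfArea n p)
  area≡pfArea n p = begin
    (+ (n ℕ.* suc n)) / 2 - ⟦ sumℕ p ⟧
      ≡⟨ cong (λ z → (+ z) / 2 - ⟦ sumℕ p ⟧) (tri-double n) ⟨
    (+ (tri (suc n) ℕ.* 2)) / 2 - ⟦ sumℕ p ⟧
      ≡⟨ cong (λ z → z / 2 - ⟦ sumℕ p ⟧) (ℤₚ.pos-* (tri (suc n)) 2) ⟩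
    (+ tri (suc n) ℤ.* + 2) / 2 - ⟦ sumℕ p ⟧
      ≡⟨ cong (_- ⟦ sumℕ p ⟧) (halve (+ tri (suc n))) ⟩
    ι (+ tri (suc n)) - ι (+ sumℕ p)
      ≡⟨ ι-- (+ tri (suc n)) (+ sumℕ p) ⟨
    ι (pfArea n p) ∎

  fallingFactorial4-ι : ∀ z → fallingFactorial4 (ι z) ≡ ι (ff 4 z)
  fallingFactorial4-ι z = begin
    ι z * (ι z - ι (+ 1)) * (ι z - ι (+ 2)) * (ι z - ι (+ 3))
      ≡⟨ cong₂ _*_ (cong₂ _*_ (cong (ι z *_) (ι-- z (+ 1))) (ι-- z (+ 2))) (ι-- z (+ 3)) ⟨
    ι z * ι (z ℤ.- + 1) * ι (z ℤ.- + 2) * ι (z ℤ.- + 3)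
      ≡⟨ cong (λ x → x * ι (z ℤ.- + 2) * ι (z ℤ.- + 3)) (ι-* z (z ℤ.- + 1)) ⟨
    ι (z ℤ.* (z ℤ.- + 1)) * ι (z ℤ.- + 2) * ι (z ℤ.- + 3)
      ≡⟨ cong (_* ι (z ℤ.- + 3)) (ι-* (z ℤ.* (z ℤ.- + 1)) (z ℤ.- + 2)) ⟨
    ι (z ℤ.* (z ℤ.- + 1) ℤ.* (z ℤ.- + 2)) * ι (z ℤ.- + 3)
      ≡⟨ ι-* (z ℤ.* (z ℤ.- + 1) ℤ.* (z ℤ.- + 2)) (z ℤ.- + 3) ⟨
    ι (z ℤ.* (z ℤ.- + 1) ℤ.* (z ℤ.- + 2) ℤ.* (z ℤ.- + 3))
      ≡⟨ cong ι (lem z) ⟩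
    ι (ff 4 z) ∎
    where
    lem : ∀ z → z ℤ.* (z ℤ.- + 1) ℤ.* (z ℤ.- + 2) ℤ.* (z ℤ.- + 3) ≡
      z ℤ.* ((z ℤ.- + 1) ℤ.* ((z ℤ.- + 1 ℤ.- + 1) ℤ.* ((z ℤ.- + 1 ℤ.- + 1 ℤ.- + 1) ℤ.* + 1)))
    lem = ℤSolver.solve-∀

  -- The zeroth falling factorial is 1, so the second factor on the left counts the parking
  -- functions; the product form postpones the division.
  moment-ratio : ∀ n → areaFactorialMoment4 n * ι (momentSum n 0 n 1) ≡ ι (momentSum n 4 n 1)
  moment-ratio n = begin
    mean (map f pfs) * ι (momentSum n 0 n 1)
      ≡⟨ cong (λ z → mean (map f pfs) * ι z) (trans (filter-length isParkingFunction (vectors n n)) (pf-sum 0 n)) ⟨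
    mean (map f pfs) * ⟦ length pfs ⟧
      ≡⟨ cong (λ l → mean (map f pfs) * ⟦ l ⟧) (Listₚ.length-map f pfs) ⟨
    mean (map f pfs) * ⟦ length (map f pfs) ⟧
      ≡⟨ mean-length (map f pfs) ⟩
    sumℚ (map f pfs)
      ≡⟨ filter-sum isParkingFunction f (λ p → ff 4 (pfArea n p))
           (λ p → trans (cong fallingFactorial4 (area≡pfArea n p)) (fallingFactorial4-ι (pfArea n p))) (vectors n n) ⟩
    ι (listSum (λ p → if isParkingFunction p then ff 4 (pfArea n p) else + 0) (vectors n n))
      ≡⟨ cong ι (pf-sum 4 n) ⟩
    ι (momentSum n 4 n 1) ∎
    where
    pfs = parkingFunctions n
    f : List ℕ → ℚ
    f p = fallingFactorial4 (area n p)

  *-cancelʳ-pos : ∀ {x y} r .{{_ : Positive r}} → x * r ≡ y * r → x ≡ y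
  *-cancelʳ-pos r e = ℚₚ.≤-antisym (ℚₚ.*-cancelʳ-≤-pos r (ℚₚ.≤-reflexive e))
                                   (ℚₚ.*-cancelʳ-≤-pos r (ℚₚ.≤-reflexive (sym e)))

  *-cancelˡ-pos : ∀ {x y} r .{{_ : Positive r}} → r * x ≡ r * y → x ≡ y
  *-cancelˡ-pos {x} {y} r e = *-cancelʳ-pos r (trans (ℚₚ.*-comm x r) (trans e (ℚₚ.*-comm r y)))

  ι-pos : ∀ k .{{_ : ℕ.NonZero k}} → Positive ⟦ k ⟧
  ι-pos k = ℚₚ.normalize-pos k 1

  -- The ratio of `h 1` to the number of parking functions

  pos-^ : ∀ m k → + (m ℕ.^ k) ≡ (+ m) ℤ.^ k
  pos-^ m zero    = refl
  pos-^ m (suc k) = trans (ℤₚ.pos-* m (m ℕ.^ k)) (cong (+ m ℤ.*_) (pos-^ m k))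

  expTerm : ℕ → ℕ → ℚ
  expTerm m k = ((+ (m ℕ.^ k)) / (k !)) {{k !≢0}}

  expSum : ℕ → ℕ → ℚ
  expSum m n = sumℚ (map (expTerm m) (upTo n))

  sumℚ-∷ʳ : ∀ xs y → sumℚ (xs ∷ʳ y) ≡ sumℚ xs + y
  sumℚ-∷ʳ []       y = trans (ℚₚ.+-identityʳ y) (sym (ℚₚ.+-identityˡ y))
  sumℚ-∷ʳ (x ∷ xs) y = trans (cong (λ z → x + z) (sumℚ-∷ʳ xs y)) (sym (ℚₚ.+-assoc x (sumℚ xs) y))

  expSum-suc : ∀ m n → expSum m (suc n) ≡ expSum m n + expTerm m n
  expSum-suc m n = begin
    sumℚ (map (expTerm m) (upTo (suc n)))          ≡⟨ cong (λ l → sumℚ (map (expTerm m) l)) (Listₚ.upTo-∷ʳ n) ⟨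
    sumℚ (map (expTerm m) (upTo n ∷ʳ n))           ≡⟨ cong sumℚ (Listₚ.map-++ (expTerm m) (upTo n) (n ∷ [])) ⟩
    sumℚ (map (expTerm m) (upTo n) ∷ʳ expTerm m n) ≡⟨ sumℚ-∷ʳ (map (expTerm m) (upTo n)) (expTerm m n) ⟩
    expSum m n + expTerm m n                       ∎

  expTerm-! : ∀ m k → ⟦ k ! ⟧ * expTerm m k ≡ ι ((+ m) ℤ.^ k)
  expTerm-! m k = trans (ℚₚ.*-comm ⟦ k ! ⟧ (expTerm m k))
    (trans (/-* (+ (m ℕ.^ k)) (k !) {{k !≢0}}) (cong ι (pos-^ m k)))

  -- The sum n + a is constant along (n, a), (n - 1, a + 1), ..., so unrolling `h 1` yields the
  -- terms n!/k! (n + a)ᵏ for k ≤ n.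
  h-1 : ∀ n a → ⟦ n ! ⟧ * expSum (n ℕ.+ a) (suc n) ≡ ι (h 1 n a)
  h-1 zero    a = refl
  h-1 (suc n) a = begin
    ⟦ suc n ! ⟧ * expSum M (suc (suc n))
      ≡⟨ cong (⟦ suc n ! ⟧ *_) (expSum-suc M (suc n)) ⟩
    ⟦ suc n ! ⟧ * (expSum M (suc n) + expTerm M (suc n))
      ≡⟨ ℚₚ.*-distribˡ-+ ⟦ suc n ! ⟧ (expSum M (suc n)) (expTerm M (suc n)) ⟩
    ⟦ suc n ! ⟧ * expSum M (suc n) + ⟦ suc n ! ⟧ * expTerm M (suc n)
      ≡⟨ cong₂ _+_ step (expTerm-! M (suc n)) ⟩
    ι (+ suc n ℤ.* h 1 n (suc a)) + ι ((+ M) ℤ.^ suc n)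
      ≡⟨ ℚₚ.+-comm (ι (+ suc n ℤ.* h 1 n (suc a))) (ι ((+ M) ℤ.^ suc n)) ⟩
    ι ((+ M) ℤ.^ suc n) + ι (+ suc n ℤ.* h 1 n (suc a))
      ≡⟨ ι-+ ((+ M) ℤ.^ suc n) (+ suc n ℤ.* h 1 n (suc a)) ⟨
    ι (h 1 (suc n) a) ∎
    where
    M = suc n ℕ.+ a
    step : ⟦ suc n ! ⟧ * expSum M (suc n) ≡ ι (+ suc n ℤ.* h 1 n (suc a))
    step = begin
      ⟦ suc n ! ⟧ * expSum M (suc n)
        ≡⟨ cong₂ (λ x m → x * expSum m (suc n))
             (trans (cong ι (ℤₚ.pos-* (suc n) (n !))) (ι-* (+ suc n) (+ (n !)))) (sym (ℕₚ.+-suc n a)) ⟩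
      ⟦ suc n ⟧ * ⟦ n ! ⟧ * expSum (n ℕ.+ suc a) (suc n)
        ≡⟨ ℚₚ.*-assoc ⟦ suc n ⟧ ⟦ n ! ⟧ _ ⟩
      ⟦ suc n ⟧ * (⟦ n ! ⟧ * expSum (n ℕ.+ suc a) (suc n))
        ≡⟨ cong (⟦ suc n ⟧ *_) (h-1 n (suc a)) ⟩
      ⟦ suc n ⟧ * ι (h 1 n (suc a))
        ≡⟨ ι-* (+ suc n) (h 1 n (suc a)) ⟨
      ι (+ suc n ℤ.* h 1 n (suc a)) ∎

  h₋₁-pos : ∀ n → Positive (ι (h₋₁ (suc n) 1))
  h₋₁-pos n = subst (λ z → Positive (ι z)) (trans (pos-^ (suc (suc n)) n) (sym (h₋₁-1 n)))
    (ι-pos (suc (suc n) ℕ.^ n) {{m^n≢0 (suc (suc n)) n}})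

  ⟦⟧-suc : ∀ n → ⟦ suc n ⟧ ≡ ⟦ n ⟧ + 1ℚ
  ⟦⟧-suc n = trans (cong ι (ℤₚ.+-comm (+ 1) (+ n))) (ι-+ (+ n) (+ 1))

  -- As (n + 1) `h₋₁ n 1` is (n + 1)ⁿ, the factor (n + 1)!/(n + 1)ⁿ in `E₁` times `h₋₁ n 1` is n!.
  -- The sum in `E₁` stops at k = n - 1; the term k = n of `h-1` accounts for n + 1 of the
  -- correction 2n + 1, and the summand -n/2 for the other n.
  E₁-h : ∀ n → (E₁ n + E₁ n + (⟦ n ⟧ + ⟦ n ⟧ + 1ℚ)) * ι (h₋₁ n 1) ≡ ι (h 1 n 1)
  E₁-h n = begin
    (E₁ n + E₁ n + (⟦ n ⟧ + ⟦ n ⟧ + 1ℚ)) * X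
      -- `half` and `ν` are independent variables for the solver, so their relation is isolated in
      -- the last term, which then vanishes.
      ≡⟨ expand half D S ν X ⟩
    D * X * S + (ν + 1ℚ) * X + (ν - half * (1ℚ + 1ℚ)) * X
      ≡⟨ cong (λ z → D * X * S + (ν + 1ℚ) * X + (ν - z) * X) (/-* (+ n) 2) ⟩
    D * X * S + (ν + 1ℚ) * X + (ν - ν) * X
      ≡⟨ cancel (D * X * S) ((ν + 1ℚ) * X) ν X ⟩
    D * X * S + (ν + 1ℚ) * X
      ≡⟨ cong₂ (λ x y → x * S + y) DX (sym pow) ⟩
    ⟦ n ! ⟧ * S + ι ((+ suc n) ℤ.^ n)
      ≡⟨ cong (λ z → ⟦ n ! ⟧ * S + z) (expTerm-! (suc n) n) ⟨
    ⟦ n ! ⟧ * S + ⟦ n ! ⟧ * expTerm (suc n) n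
      ≡⟨ ℚₚ.*-distribˡ-+ ⟦ n ! ⟧ S (expTerm (suc n) n) ⟨
    ⟦ n ! ⟧ * (S + expTerm (suc n) n)
      ≡⟨ cong (⟦ n ! ⟧ *_) (expSum-suc (suc n) n) ⟨
    ⟦ n ! ⟧ * expSum (suc n) (suc n)
      ≡⟨ cong (λ m → ⟦ n ! ⟧ * expSum m (suc n)) (ℕₚ.+-comm 1 n) ⟩
    ⟦ n ! ⟧ * expSum (n ℕ.+ 1) (suc n)
      ≡⟨ h-1 n 1 ⟩
    ι (h 1 n 1) ∎
    where
    ν = ⟦ n ⟧
    X = ι (h₋₁ n 1)
    S = expSum (suc n) n
    half = (+ n) / 2
    D = ((+ (suc n !)) / (suc n ℕ.^ n)) {{m^n≢0 (suc n) n}}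
    expand : ∀ f d s v x → (- f + (+ 1) / 2 * d * s + (- f + (+ 1) / 2 * d * s) + (v + v + 1ℚ)) * x
             ≡ d * x * s + (v + 1ℚ) * x + (v - f * (1ℚ + 1ℚ)) * x
    expand f d s v x = solve (f ∷ d ∷ s ∷ v ∷ x ∷ []) ℚ-ring
    cancel : ∀ a b v x → a + b + (v - v) * x ≡ a + b
    cancel a b v x = solve (a ∷ b ∷ v ∷ x ∷ []) ℚ-ring
    pow : ι ((+ suc n) ℤ.^ n) ≡ (ν + 1ℚ) * X
    pow = begin
      ι ((+ suc n) ℤ.^ n)            ≡⟨ cong (λ m → ι ((+ m) ℤ.^ n)) (ℕₚ.+-comm 1 n) ⟩
      ι (h 0 n 1)                    ≡⟨ cong ι (h-0-1 n) ⟩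
      ι ((+ n ℤ.+ + 1) ℤ.* h₋₁ n 1)   ≡⟨ ι-* (+ n ℤ.+ + 1) (h₋₁ n 1) ⟩
      ι (+ n ℤ.+ + 1) * X            ≡⟨ cong (_* X) (ι-+ (+ n) (+ 1)) ⟩
      (ν + 1ℚ) * X                   ∎
    DX : D * X ≡ ⟦ n ! ⟧
    DX = *-cancelʳ-pos ⟦ suc n ⟧ {{ι-pos (suc n)}} (begin
      D * X * ⟦ suc n ⟧                ≡⟨ ℚₚ.*-assoc D X ⟦ suc n ⟧ ⟩
      D * (X * ⟦ suc n ⟧)              ≡⟨ cong (D *_) (trans (ℚₚ.*-comm X ⟦ suc n ⟧) (cong (_* X) (⟦⟧-suc n))) ⟩
      D * ((ν + 1ℚ) * X)               ≡⟨ cong (D *_) (trans (cong ι (pos-^ (suc n) n)) pow) ⟨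
      D * ⟦ suc n ℕ.^ n ⟧              ≡⟨ /-* (+ (suc n !)) (suc n ℕ.^ n) {{m^n≢0 (suc n) n}} ⟩
      ι (+ (suc n !))                  ≡⟨ cong ι (ℤₚ.pos-* (suc n) (n !)) ⟩
      ι (+ suc n ℤ.* + (n !))          ≡⟨ ι-* (+ suc n) (+ (n !)) ⟩
      ⟦ suc n ⟧ * ⟦ n ! ⟧              ≡⟨ ℚₚ.*-comm ⟦ suc n ⟧ ⟦ n ! ⟧ ⟩
      ⟦ n ! ⟧ * ⟦ suc n ⟧              ∎)

  -- The exact formula

  hornerℚ : Row → ℚ → ℚ
  hornerℚ []      x = 0ℚ
  hornerℚ (c ∷ r) x = ι c + x * hornerℚ r x

  ι-horner : ∀ r i → ι (horner r i) ≡ hornerℚ r (ι i)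
  ι-horner []      i = refl
  ι-horner (c ∷ r) i = trans (ι-+ c (i ℤ.* horner r i))
    (cong (λ z → ι c + z) (trans (ι-* i (horner r i)) (cong (ι i *_) (ι-horner r i))))

  scaled-moment : ∀ n → ι (+ 87091200) * areaFactorialMoment4 (suc n) ≡
    hornerℚ p₄ ⟦ suc n ⟧ + hornerℚ q₄ ⟦ suc n ⟧ * (E₁ (suc n) + E₁ (suc n) + (⟦ suc n ⟧ + ⟦ suc n ⟧ + 1ℚ))
  scaled-moment m = *-cancelʳ-pos X {{h₋₁-pos m}} (begin
    K * M * X
      ≡⟨ ℚₚ.*-assoc K M X ⟩
    K * (M * X)
      ≡⟨ cong (λ z → K * (M * ι z)) (momentSum-0 n) ⟨
    K * (M * ι (momentSum n 0 n 1))
      ≡⟨ cong (K *_) (moment-ratio n) ⟩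
    K * ι (momentSum n 4 n 1)
      ≡⟨ trans (cong ι (sym (momentSum-4 n))) (ι-* (+ 87091200) (momentSum n 4 n 1)) ⟨
    ι (horner p₄ (+ n) ℤ.* h₋₁ n 1 ℤ.+ horner q₄ (+ n) ℤ.* h 1 n 1)
      ≡⟨ ι-+ (horner p₄ (+ n) ℤ.* h₋₁ n 1) (horner q₄ (+ n) ℤ.* h 1 n 1) ⟩
    ι (horner p₄ (+ n) ℤ.* h₋₁ n 1) + ι (horner q₄ (+ n) ℤ.* h 1 n 1)
      ≡⟨ cong₂ _+_ (trans (ι-* (horner p₄ (+ n)) (h₋₁ n 1)) (cong (_* X) (ι-horner p₄ (+ n))))
                   (trans (ι-* (horner q₄ (+ n)) (h 1 n 1)) (cong₂ _*_ (ι-horner q₄ (+ n)) (sym (E₁-h n)))) ⟩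
    P * X + Q * (W * X)
      ≡⟨ lem P Q W X ⟩
    (P + Q * W) * X ∎)
    where
    n = suc m
    K = ι (+ 87091200)
    M = areaFactorialMoment4 n
    X = ι (h₋₁ n 1)
    P = hornerℚ p₄ ⟦ n ⟧
    Q = hornerℚ q₄ ⟦ n ⟧
    W = E₁ n + E₁ n + (⟦ n ⟧ + ⟦ n ⟧ + 1ℚ)
    lem : ∀ p q w x → p * x + q * (w * x) ≡ (p + q * w) * x
    lem p q w x = solve (p ∷ q ∷ w ∷ x ∷ []) ℚ-ring

  -- Both sides are written as `_^q_` and `hornerℚ` unfold, so that the solver meets only ring
  -- operations; `e` stands for `E₁`. The summand 2x + 1 of the ratio moves part of `q₄` into the
  -- terms free of `e`.
  formula : ∀ x e → ι (+ 87091200) * (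
          ((+ 221) / 1008) * (x * (x * (x * (x * (x * (x * 1ℚ))))))
          + ((+ 63737) / 30240) * (x * (x * (x * (x * (x * 1ℚ)))))
          + ((+ 101897) / 15120) * (x * (x * (x * (x * 1ℚ))))
          + ((+ 22217) / 5040) * (x * (x * (x * 1ℚ)))
          - ((+ 1375) / 189) * (x * (x * 1ℚ))
          - ((+ 187463) / 30240) * x
          + ( - (((+ 35) / 16) * (x * (x * (x * (x * 1ℚ)))))
              - ((+ 449) / 27) * (x * (x * (x * 1ℚ)))
              - ((+ 130243) / 2520) * (x * (x * 1ℚ))
              - ((+ 7409) / 105) * x
              - (+ 503803) / 15120 ) * e) ≡ (ι (+ 1450952640) + x * (ι (+ 5434672320) + x * (ι (+ 7762320000)
                + x * (ι (+ 5609255040) + x * (ι (+ 2130477120) + x * (ι (+ 374074560)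
                + x * (ι (+ 19094400) + x * 0ℚ)))))))
        + (ι (ℤ.- + 1450952640) + x * (ι (ℤ.- + 3072660480) + x * (ι (ℤ.- + 2250599040)
          + x * (ι (ℤ.- + 724147200) + x * (ι (ℤ.- + 95256000) + x * 0ℚ))))) * (e + e + (x + x + 1ℚ))
  formula x e = solve (x ∷ e ∷ []) ℚ-ring

  -- The asymptotic bound

  ι-nonneg : ∀ {i} → + 0 ℤ.≤ i → 0ℚ ≤ℚ ι i
  ι-nonneg {+ n} _ = ℚₚ.nonNegative⁻¹ (ι (+ n)) {{ℚₚ.normalize-nonNeg n 1}}

  ℚ-+-nonneg : ∀ {x y} → 0ℚ ≤ℚ x → 0ℚ ≤ℚ y → 0ℚ ≤ℚ x + y
  ℚ-+-nonneg = ℚₚ.+-mono-≤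

  ℚ-*-nonneg : ∀ {x y} → 0ℚ ≤ℚ x → 0ℚ ≤ℚ y → 0ℚ ≤ℚ x * y
  ℚ-*-nonneg {x} {y} p q = ℚₚ.nonNegative⁻¹ (x * y)
    {{ℚₚ.nonNeg*nonNeg⇒nonNeg x {{nonNegative p}} y {{nonNegative q}}}}

  square-nonneg : ∀ x → 0ℚ ≤ℚ x * x
  square-nonneg x with ℚₚ.≤-total 0ℚ x
  ... | inj₁ p = ℚ-*-nonneg p p
  ... | inj₂ p = subst (0ℚ ≤ℚ_) (lem x) (ℚ-*-nonneg q q)
    where
    q : 0ℚ ≤ℚ - x
    q = ℚₚ.neg-antimono-≤ p
    lem : ∀ x → (- x) * (- x) ≡ x * x
    lem x = solve (x ∷ []) ℚ-ring

  nonneg-cancel : ∀ {x} r .{{_ : Positive r}} → 0ℚ ≤ℚ x * r → 0ℚ ≤ℚ x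
  nonneg-cancel {x} r p = ℚₚ.*-cancelʳ-≤-pos r (subst (_≤ℚ x * r) (sym (ℚₚ.*-zeroˡ r)) p)

  ⟦⟧-nonneg : ∀ n → 0ℚ ≤ℚ ⟦ n ⟧
  ⟦⟧-nonneg n = ι-nonneg {+ n} (+≤+ z≤n)

  ⟦⟧-^ : ∀ n d → ⟦ n ℕ.^ d ⟧ ≡ ⟦ n ⟧ ^q d
  ⟦⟧-^ n zero    = refl
  ⟦⟧-^ n (suc d) = trans (cong ι (ℤₚ.pos-* n (n ℕ.^ d))) (trans (ι-* (+ n) (+ (n ℕ.^ d))) (cong (⟦ n ⟧ *_) (⟦⟧-^ n d)))

  hornerℚ-bound : ∀ r d n → length r ℕ.≤ suc d →
    0ℚ ≤ℚ ⟦ absSum r ⟧ * ⟦ suc n ⟧ ^q d * (⟦ absSum r ⟧ * ⟦ suc n ⟧ ^q d) - hornerℚ r ⟦ suc n ⟧ * hornerℚ r ⟦ suc n ⟧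
  hornerℚ-bound r d n l = subst (0ℚ ≤ℚ_) (begin
    ι (+ m ℤ.* + m ℤ.- i ℤ.* i)
      ≡⟨ ι-- (+ m ℤ.* + m) (i ℤ.* i) ⟩
    ι (+ m ℤ.* + m) - ι (i ℤ.* i)
      ≡⟨ cong₂ _-_ (ι-* (+ m) (+ m)) (ι-* i i) ⟩
    ⟦ m ⟧ * ⟦ m ⟧ - ι i * ι i
      ≡⟨ cong₂ (λ x y → x * x - y * y)
           (trans (cong ι (ℤₚ.pos-* (absSum r) (suc n ℕ.^ d)))
             (trans (ι-* (+ absSum r) (+ (suc n ℕ.^ d))) (cong (⟦ absSum r ⟧ *_) (⟦⟧-^ (suc n) d))))
           (ι-horner r (+ suc n)) ⟩
    ⟦ absSum r ⟧ * ⟦ suc n ⟧ ^q d * (⟦ absSum r ⟧ * ⟦ suc n ⟧ ^q d) - hornerℚ r ⟦ suc n ⟧ * hornerℚ r ⟦ suc n ⟧ ∎)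
    (ι-nonneg (square-bound i m (horner-bound r d n l)))
    where
    i = horner r (+ suc n)
    m = absSum r ℕ.* suc n ℕ.^ d

  -- At a = 1 both `h 0` and `h 2` are multiples of `h₋₁`, which leaves a quadratic relation between
  -- `h₋₁` and `h 1` only.
  h-quadratic-1 : ∀ n → + 0 ℤ.≤ (+ 2 ℤ.* (+ n ℤ.+ + 1) ℤ.* (+ n ℤ.+ + 1) ℤ.* (+ n ℤ.+ + 1) ℤ.* (h₋₁ n 1 ℤ.* h₋₁ n 1)
    ℤ.- h 1 n 1 ℤ.* h 1 n 1 ℤ.- (+ n ℤ.+ + 1) ℤ.* (h₋₁ n 1 ℤ.* h 1 n 1))
  h-quadratic-1 n = subst (+ 0 ℤ.≤_) (begin
    + 2 ℤ.* h 0 n 1 ℤ.* h 2 n 1 ℤ.- y ℤ.* y ℤ.- h 0 n 1 ℤ.* y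
      ≡⟨ cong₂ (λ u v → + 2 ℤ.* u ℤ.* v ℤ.- y ℤ.* y ℤ.- u ℤ.* y) (h-0-1 n) h-2 ⟩
    + 2 ℤ.* (N ℤ.* x) ℤ.* (N ℤ.* (N ℤ.* x)) ℤ.- y ℤ.* y ℤ.- (N ℤ.* x) ℤ.* y
      ≡⟨ lem₂ N x y ⟩
    + 2 ℤ.* N ℤ.* N ℤ.* N ℤ.* (x ℤ.* x) ℤ.- y ℤ.* y ℤ.- N ℤ.* (x ℤ.* y) ∎)
    (h-quadratic n 1)
    where
    N = + n ℤ.+ + 1
    x = h₋₁ n 1
    y = h 1 n 1
    lem₁ : ∀ m u y → m ℤ.* u ℤ.+ + 0 ℤ.* y ≡ m ℤ.* u
    lem₁ = ℤSolver.solve-∀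
    h-2 : h 2 n 1 ≡ N ℤ.* (N ℤ.* x)
    h-2 = trans (sym (ℤₚ.*-identityˡ (h 2 n 1))) (trans (h-rel 0 n 1) (trans (lem₁ N (h 0 n 1) y) (cong (N ℤ.*_) (h-0-1 n))))
    lem₂ : ∀ m x y → + 2 ℤ.* (m ℤ.* x) ℤ.* (m ℤ.* (m ℤ.* x)) ℤ.- y ℤ.* y ℤ.- (m ℤ.* x) ℤ.* y
           ≡ + 2 ℤ.* m ℤ.* m ℤ.* m ℤ.* (x ℤ.* x) ℤ.- y ℤ.* y ℤ.- m ℤ.* (x ℤ.* y)
    lem₂ = ℤSolver.solve-∀

  -- Let w = 2 E₁ + 2n + 1 be the ratio of `h 1` to `h₋₁`. The quadratic relation reads w² + (n + 1)
  -- w ≤ 2 (n + 1)³, and as w ≥ 0, the square of 2 E₁ = w - (2n + 1) is at most w² + (2n + 1)².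
  E₁-bound : ∀ m → let n = suc m in
    0ℚ ≤ℚ ⟦ 25 ⟧ * (⟦ n ⟧ * (⟦ n ⟧ * ⟦ n ⟧)) - ⟦ 4 ⟧ * (E₁ n * E₁ n)
  E₁-bound m = subst (0ℚ ≤ℚ_) (trans (lem e μ) (cong (λ z → ⟦ 25 ⟧ * (z * (z * z)) - ⟦ 4 ⟧ * (e * e)) (sym (⟦⟧-suc m))))
    (ℚ-+-nonneg (ℚ-+-nonneg (ℚ-+-nonneg quadratic (ℚ-*-nonneg (ℚ-+-nonneg μ≥0 (⟦⟧-nonneg 2)) w≥0))
      (ℚ-*-nonneg (ℚ-*-nonneg (⟦⟧-nonneg 2) w≥0) (ℚ-+-nonneg (ℚ-*-nonneg (⟦⟧-nonneg 2) μ≥0) (⟦⟧-nonneg 3))))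
      -- This is 25 n³ - 2 (n + 1)³ - (2n + 1)² at n = μ + 1. It vanishes at n = 1, which is the
      -- origin of the 25.
      (ℚ-*-nonneg μ≥0 (ℚ-+-nonneg (⟦⟧-nonneg 39) (ℚ-*-nonneg μ≥0 (ℚ-+-nonneg (⟦⟧-nonneg 59) (ℚ-*-nonneg μ≥0 (⟦⟧-nonneg 23)))))))
    where
    n = suc m
    μ = ⟦ m ⟧
    e = E₁ n
    X = ι (h₋₁ n 1)
    Y = ι (h 1 n 1)
    w : ℚ → ℚ
    w e = e + e + (⟦ 2 ⟧ * μ + ⟦ 3 ⟧)
    μ≥0 : 0ℚ ≤ℚ μ
    μ≥0 = ⟦⟧-nonneg m
    wX : w e * X ≡ Y
    wX = trans (cong (_* X) (trans (lem₁ e μ) (cong (λ z → e + e + (z + z + 1ℚ)) (sym (⟦⟧-suc m))))) (E₁-h n)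
      where
      lem₁ : ∀ e μ → e + e + (⟦ 2 ⟧ * μ + ⟦ 3 ⟧) ≡ e + e + (μ + 1ℚ + (μ + 1ℚ) + 1ℚ)
      lem₁ e μ = solve (e ∷ μ ∷ []) ℚ-ring
    w≥0 : 0ℚ ≤ℚ w e
    w≥0 = nonneg-cancel X {{h₋₁-pos m}} (subst (0ℚ ≤ℚ_) (sym wX) (ι-nonneg (h-nonneg 1 n 1)))
    quadratic : 0ℚ ≤ℚ ⟦ 2 ⟧ * (μ + ⟦ 2 ⟧) * (μ + ⟦ 2 ⟧) * (μ + ⟦ 2 ⟧) - w e * w e - (μ + ⟦ 2 ⟧) * w e
    quadratic = nonneg-cancel X {{h₋₁-pos m}} (nonneg-cancel X {{h₋₁-pos m}} (subst (0ℚ ≤ℚ_) (begin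
      ι (+ 2 ℤ.* N ℤ.* N ℤ.* N ℤ.* (x ℤ.* x) ℤ.- y ℤ.* y ℤ.- N ℤ.* (x ℤ.* y))
        ≡⟨ trans (ι-- (+ 2 ℤ.* N ℤ.* N ℤ.* N ℤ.* (x ℤ.* x) ℤ.- y ℤ.* y) (N ℤ.* (x ℤ.* y)))
             (cong₂ _-_ (ι-- (+ 2 ℤ.* N ℤ.* N ℤ.* N ℤ.* (x ℤ.* x)) (y ℤ.* y)) (trans (ι-* N (x ℤ.* y)) (cong (ι N *_) (ι-* x y)))) ⟩
      ι (+ 2 ℤ.* N ℤ.* N ℤ.* N ℤ.* (x ℤ.* x)) - ι (y ℤ.* y) - ι N * (X * Y)
        ≡⟨ cong₂ (λ u v → u - v - ι N * (X * Y))
             (trans (ι-* (+ 2 ℤ.* N ℤ.* N ℤ.* N) (x ℤ.* x)) (cong₂ _*_ (trans (ι-* (+ 2 ℤ.* N ℤ.* N) N)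
               (cong (_* ι N) (trans (ι-* (+ 2 ℤ.* N) N) (cong (_* ι N) (ι-* (+ 2) N))))) (ι-* x x)))
             (ι-* y y) ⟩
      ⟦ 2 ⟧ * ι N * ι N * ι N * (X * X) - Y * Y - ι N * (X * Y)
        ≡⟨ cong₂ (λ N Y → ⟦ 2 ⟧ * N * N * N * (X * X) - Y * Y - N * (X * Y)) ιN (sym wX) ⟩
      ⟦ 2 ⟧ * M * M * M * (X * X) - w e * X * (w e * X) - M * (X * (w e * X))
        ≡⟨ lem₂ M (w e) X ⟩
      (⟦ 2 ⟧ * M * M * M - w e * w e - M * w e) * X * X ∎)
      (ι-nonneg (h-quadratic-1 n))))
      where
      N = + n ℤ.+ + 1
      M = μ + ⟦ 2 ⟧
      x = h₋₁ n 1
      y = h 1 n 1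
      ιN : ι N ≡ M
      ιN = trans (cong ι (trans (ℤₚ.+-comm (+ n) (+ 1)) (ℤₚ.+-comm (+ 2) (+ m)))) (ι-+ (+ m) (+ 2))
      lem₂ : ∀ m w x → ⟦ 2 ⟧ * m * m * m * (x * x) - w * x * (w * x) - m * (x * (w * x))
             ≡ (⟦ 2 ⟧ * m * m * m - w * w - m * w) * x * x
      lem₂ m w x = solve (m ∷ w ∷ x ∷ []) ℚ-ring
    lem : ∀ e μ → let w = e + e + (⟦ 2 ⟧ * μ + ⟦ 3 ⟧) in
      ⟦ 2 ⟧ * (μ + ⟦ 2 ⟧) * (μ + ⟦ 2 ⟧) * (μ + ⟦ 2 ⟧) - w * w - (μ + ⟦ 2 ⟧) * w
        + (μ + ⟦ 2 ⟧) * w + ⟦ 2 ⟧ * w * (⟦ 2 ⟧ * μ + ⟦ 3 ⟧)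
        + μ * (⟦ 39 ⟧ + μ * (⟦ 59 ⟧ + μ * ⟦ 23 ⟧))
      ≡ ⟦ 25 ⟧ * ((μ + 1ℚ) * ((μ + 1ℚ) * (μ + 1ℚ))) - ⟦ 4 ⟧ * (e * e)
    lem e μ = solve (e ∷ μ ∷ []) ℚ-ring

  -- What the scaled moment leaves after 221/1008 n⁶ is removed: `b₄` is twice `q₄`, and `a₄` is
  -- `p₄` without its top term plus (2x + 1) times `q₄`. The degrees 5 and 4 with E₁ = O(n^{3/2})
  -- give the exponent 11/2.
  a₄ b₄ : Row
  a₄ = + 0 ∷ ℤ.- + 539893440 ∷ ℤ.- + 633600000 ∷ + 383909760 ∷ + 586926720 ∷ + 183562560 ∷ []
  b₄ = ℤ.- + 2901905280 ∷ ℤ.- + 6145320960 ∷ ℤ.- + 4501198080 ∷ ℤ.- + 1448294400 ∷ ℤ.- + 190512000 ∷ []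

  remainder : ∀ x e → (ι (+ 1450952640) + x * (ι (+ 5434672320) + x * (ι (+ 7762320000)
    + x * (ι (+ 5609255040) + x * (ι (+ 2130477120) + x * (ι (+ 374074560)
    + x * (ι (+ 19094400) + x * 0ℚ)))))))
      + (ι (ℤ.- + 1450952640) + x * (ι (ℤ.- + 3072660480) + x * (ι (ℤ.- + 2250599040)
        + x * (ι (ℤ.- + 724147200) + x * (ι (ℤ.- + 95256000) + x * 0ℚ))))) * (e + e + (x + x + 1ℚ))
      - ι (+ 87091200) * ((+ 221 / 1008) * (x * (x * (x * (x * (x * (x * 1ℚ)))))))
    ≡ (ι (+ 0) + x * (ι (ℤ.- + 539893440) + x * (ι (ℤ.- + 633600000)
      + x * (ι (+ 383909760) + x * (ι (+ 586926720) + x * (ι (+ 183562560) + x * 0ℚ))))))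
      + (ι (ℤ.- + 2901905280) + x * (ι (ℤ.- + 6145320960) + x * (ι (ℤ.- + 4501198080)
        + x * (ι (ℤ.- + 1448294400) + x * (ι (ℤ.- + 190512000) + x * 0ℚ))))) * e
  remainder x e = solve (x ∷ e ∷ []) ℚ-ring

  scaled-remainder : ∀ m → let n = suc m in
    ι (+ 87091200) * (areaFactorialMoment4 n - (+ 221 / 1008) * (⟦ n ⟧ ^q 6)) ≡ hornerℚ a₄ ⟦ n ⟧ + hornerℚ b₄ ⟦ n ⟧ * E₁ n
  scaled-remainder m = begin
    K * (M - c)
      ≡⟨ lem K M c ⟩
    K * M - K * c
      ≡⟨ cong (_- K * c) (scaled-moment m) ⟩
    hornerℚ p₄ ⟦ n ⟧ + hornerℚ q₄ ⟦ n ⟧ * (E₁ n + E₁ n + (⟦ n ⟧ + ⟦ n ⟧ + 1ℚ)) - K * c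
      ≡⟨ remainder ⟦ n ⟧ (E₁ n) ⟩
    hornerℚ a₄ ⟦ n ⟧ + hornerℚ b₄ ⟦ n ⟧ * E₁ n ∎
    where
    n = suc m
    K = ι (+ 87091200)
    M = areaFactorialMoment4 n
    c = (+ 221 / 1008) * (⟦ n ⟧ ^q 6)
    lem : ∀ k m c → k * (m - c) ≡ k * m - k * c
    lem k m c = solve (k ∷ m ∷ c ∷ []) ℚ-ring

  -- (a + b e)² = 2 a² + 2 b² e² - (a - b e)², so the terms before the last sum to a non-negative slack.
  -- The first two constants are absSum a₄ and absSum b₄, and the third is what these leave of
  -- (1000 · 87091200)².
  square-split : ∀ x μ a b e → x ≡ μ + 1ℚ →
    let sa = ⟦ 2327892480 ⟧ * (x * (x * (x * (x * (x * 1ℚ)))))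
        sb = ⟦ 15187230720 ⟧ * (x * (x * (x * (x * 1ℚ))))
    in ⟦ 2 ⟧ * (sa * sa - a * a) + ⟦ 2 ⟧ * ((sb * sb - b * b) * (e * e))
       + (+ 1 / 2) * (sb * sb * (⟦ 25 ⟧ * (x * (x * x)) - ⟦ 4 ⟧ * (e * e)))
       + (a - b * e) * (a - b * e) + ⟦ 2 ⟧ * (sa * sa * μ) + ⟦ 4690889238861722419200 ⟧ * (x * (x * (x * (x * (x * (x * (x * (x * (x * (x * (x * 1ℚ)))))))))))
       + (a + b * e) * (a + b * e)
    ≡ ι (+ 87091200) * ι (+ 87091200) * (⟦ 1000 ⟧ * ⟦ 1000 ⟧ * (x * (x * (x * (x * (x * (x * (x * (x * (x * (x * (x * 1ℚ))))))))))))
  square-split .(μ + 1ℚ) μ a b e refl = solve (μ ∷ a ∷ b ∷ e ∷ []) ℚ-ring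

  -- Squaring keeps n^{11/2} within the rationals. Scaled by 87091200², the claim is `square-split`
  -- with its non-negative part `R` dropped.
  remainder-bound : ∀ m → let n = suc m in
    ((areaFactorialMoment4 n - (+ 221 / 1008) * (⟦ n ⟧ ^q 6)) ^q 2) ≤ℚ (⟦ 1000 ⟧ * ⟦ 1000 ⟧) * (⟦ n ⟧ ^q 11)
  remainder-bound m = ℚₚ.*-cancelˡ-≤-pos (K * K) {{ℚₚ.pos*pos⇒pos K {{ι-pos 87091200}} K {{ι-pos 87091200}}}}
    (subst₂ _≤ℚ_ lhs (square-split x μ a b e (⟦⟧-suc m)) (subst (_≤ℚ R + (a + b * e) * (a + b * e)) (ℚₚ.+-identityˡ _)
      (ℚₚ.+-monoˡ-≤ ((a + b * e) * (a + b * e)) R≥0)))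
    where
    n = suc m
    x = ⟦ n ⟧
    μ = ⟦ m ⟧
    e = E₁ n
    a = hornerℚ a₄ x
    b = hornerℚ b₄ x
    K = ι (+ 87091200)
    Z = areaFactorialMoment4 n - (+ 221 / 1008) * (x ^q 6)
    sa = ⟦ 2327892480 ⟧ * x ^q 5
    sb = ⟦ 15187230720 ⟧ * x ^q 4
    R = ⟦ 2 ⟧ * (sa * sa - a * a) + ⟦ 2 ⟧ * ((sb * sb - b * b) * (e * e))
       + (+ 1 / 2) * (sb * sb * (⟦ 25 ⟧ * (x * (x * x)) - ⟦ 4 ⟧ * (e * e)))
       + (a - b * e) * (a - b * e) + ⟦ 2 ⟧ * (sa * sa * μ) + ⟦ 4690889238861722419200 ⟧ * x ^q 11
    lhs : (a + b * e) * (a + b * e) ≡ K * K * (Z ^q 2)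
    lhs = trans (cong (λ z → z * z) (sym (scaled-remainder m))) (lem K Z)
      where
      lem : ∀ k z → k * z * (k * z) ≡ k * k * (z * (z * 1ℚ))
      lem k z = solve (k ∷ z ∷ []) ℚ-ring
    x^≥0 : ∀ d → 0ℚ ≤ℚ x ^q d
    x^≥0 d = subst (0ℚ ≤ℚ_) (⟦⟧-^ n d) (⟦⟧-nonneg (n ℕ.^ d))
    R≥0 : 0ℚ ≤ℚ R
    R≥0 = ℚ-+-nonneg (ℚ-+-nonneg (ℚ-+-nonneg (ℚ-+-nonneg (ℚ-+-nonneg
      (ℚ-*-nonneg (⟦⟧-nonneg 2) (hornerℚ-bound a₄ 5 m ℕₚ.≤-refl))
      (ℚ-*-nonneg (⟦⟧-nonneg 2) (ℚ-*-nonneg (hornerℚ-bound b₄ 4 m ℕₚ.≤-refl) (square-nonneg e))))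
      (ℚ-*-nonneg (ℚₚ.nonNegative⁻¹ (+ 1 / 2)) (ℚ-*-nonneg (square-nonneg sb) (E₁-bound m))))
      (square-nonneg (a - b * e)))
      -- The factor μ = n - 1 lifts 2 sa² from degree 10 to degree 11.
      (ℚ-*-nonneg (⟦⟧-nonneg 2) (ℚ-*-nonneg (square-nonneg sa) (⟦⟧-nonneg m))))
      (ℚ-*-nonneg (⟦⟧-nonneg 4690889238861722419200) (x^≥0 11))

open import Data.Nat using (_≤_)
open import Data.Integer using (+_)
open import Data.Rational using (ℚ; _/_; _+_; _*_; _-_; -_) renaming (_≤_ to _≤ℚ_)

theorem4 : (∀ (n : ℕ) → 1 ≤ n →
    areaFactorialMoment4 n ≡
    ((+ 221) / 1008) * (⟦ n ⟧ ^q 6)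
    + ((+ 63737) / 30240) * (⟦ n ⟧ ^q 5)
    + ((+ 101897) / 15120) * (⟦ n ⟧ ^q 4)
    + ((+ 22217) / 5040) * (⟦ n ⟧ ^q 3)
    - ((+ 1375) / 189) * (⟦ n ⟧ ^q 2)
    - ((+ 187463) / 30240) * ⟦ n ⟧
    + ( - (((+ 35) / 16) * (⟦ n ⟧ ^q 4))
    - ((+ 449) / 27) * (⟦ n ⟧ ^q 3)
    - ((+ 130243) / 2520) * (⟦ n ⟧ ^q 2)
    - ((+ 7409) / 105) * ⟦ n ⟧
    - (+ 503803) / 15120 ) * E₁ n)
    × (∃[ C ] ∃[ N ] ∀ (n : ℕ) → N ≤ n →
    ((areaFactorialMoment4 n - ((+ 221) / 1008) * (⟦ n ⟧ ^q 6)) ^q 2)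
    ≤ℚ (C * C) * (⟦ n ⟧ ^q 11))
theorem4 =
  (λ { (suc m) _ → *-cancelˡ-pos (ι (+ 87091200)) {{ι-pos 87091200}}
         (trans (scaled-moment m) (sym (formula ⟦ suc m ⟧ (E₁ (suc m))))) }) ,
  -- The estimate consumes 2 (absSum a₄)² + 25/2 (absSum b₄)² out of (87091200 C)², for which C =
  -- 618 is enough; 1000 is a round choice.
  ⟦ 1000 ⟧ , 1 , λ { (suc m) _ → remainder-bound m }
  where open Expectation
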